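{- Fix an integer $k>0$. The sequence $\left(\#(SL_k(\mathbb{Z}/n\mathbb{Z}))\right)_{n\in\mathbb{N}}$ is Ces\`aro equivalent as $n\to\infty$ to the sequence $\left(C_1(k)\,n^{k^2-1}\right)_{n\in\mathbb{N}}$, and the sequence $\left(\#(GL_k(\mathbb{Z}/n\mathbb{Z}))\right)_{n\in\mathbb{N}}$ is Ces\`aro equivalent as $n\to\infty$ to $\left(C_2(k)\,n^{k^2}\right)_{n\in\mathbb{N}}$, where $C_1(1)=1$, $C_2(1)=\prod_p\left(1-\frac{1}{p^2}\right)$, and for every $k>1$ $$C_1(k)=\prod_p\left(1-\frac{1}{p}\left(1-\prod_{i=2}^k\left(1-\frac{1}{p^i}\right)\right)\right),\qquad C_2(k)=\prod_p\left(1-\frac{1}{p}\left(1-\prod_{i=1}^k\left(1-\frac{1}{p^i}\right)\right)\right).$$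
   Context: $\#(X)$ denotes the cardinality of a finite set $X$; $\prod_p$ denotes the product over all prime numbers. Two sequences of real numbers $(x_n)_{n\in\mathbb{N}}$ and $(y_n)_{n\in\mathbb{N}}$ are called Ces\`aro equivalent if $\lim_{n\to\infty}\frac{x_1+\cdots+x_n}{y_1+\cdots+y_n}=1$. -}

module Defs where

open import Data.Nat as ℕ using (ℕ; zero; suc)
open import Data.Nat.GCD using (gcd)
open import Data.Nat.Primality using (prime?)
open import Data.Integer as ℤ using (ℤ; +_)
open import Data.Integer.DivMod using (_%ℕ_)
open import Data.Rational as ℚ using (ℚ)
open import Data.Fin using (Fin; toℕ; punchIn; zero; suc)
open import Data.List using (List; []; _∷_; [_]; map; concatMap; filter; length; allFin; foldr)
open import Data.Vec.Functional using (Vector)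
open import Relation.Nullary.Decidable using (does)
open import Data.Bool using (if_then_else_)
open import Relation.Binary.PropositionalEquality using (_≡_)

Matrix : Set → ℕ → Set
Matrix A k = Fin k → Fin k → A

sgn : ℕ → ℤ
sgn zero = ℤ.1ℤ
sgn (suc j) = ℤ.- sgn j

det : {k : ℕ} → Matrix ℤ k → ℤ
det {zero} M = ℤ.1ℤ
det {suc k} M =
  foldr ℤ._+_ ℤ.0ℤ
    (map (λ j → sgn (toℕ j) ℤ.* M zero j ℤ.* det (λ i j' → M (suc i) (punchIn j j')))
         (allFin (suc k)))

-- list of all functions Fin k → A, given a complete duplicate-free list of A
allFuns : {A : Set} → List A → (k : ℕ) → List (Fin k → A)
allFuns xs zero = [ (λ ()) ]
allFuns xs (suc k) =
  concatMap (λ x → map (λ f → λ { zero → x ; (suc i) → f i }) (allFuns xs k)) xs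

-- all k × k matrices over ℤ/nℤ (entries represented by Fin n = {0,…,n-1})
allMatrices : (n k : ℕ) → List (Matrix (Fin n) k)
allMatrices n k = allFuns (allFuns (allFin n) k) k

lift : {n k : ℕ} → Matrix (Fin n) k → Matrix ℤ k
lift M i j = + toℕ (M i j)

-- #(SL_k(ℤ/nℤ)) for n = suc m : matrices with det ≡ 1 (mod n)
#SL : (k m : ℕ) → ℕ
#SL k m = length (filter (λ M → ((det (lift M) ℤ.- ℤ.1ℤ) %ℕ suc m) ℕ.≟ 0)
                         (allMatrices (suc m) k))

-- #(GL_k(ℤ/nℤ)) for n = suc m : matrices whose det is a unit mod n
#GL : (k m : ℕ) → ℕ
#GL k m = length (filter (λ M → gcd (det (lift M) %ℕ suc m) (suc m) ℕ.≟ 1)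
                         (allMatrices (suc m) k))

sumTo : (ℕ → ℕ) → ℕ → ℕ
sumTo f zero = 0
sumTo f (suc N) = sumTo f N ℕ.+ f (suc N)

-- the sequence n ↦ #SL_k(ℤ/nℤ), n ≥ 1 (value at 0 irrelevant, never summed)
seqSL : ℕ → ℕ → ℕ
seqSL k zero = 0
seqSL k (suc m) = #SL k m

seqGL : ℕ → ℕ → ℕ
seqGL k zero = 0
seqGL k (suc m) = #GL k m

qN : ℕ → ℚ
qN n = (+ n) ℚ./ 1

-- 1/m as a rational (m > 0 in all uses)
inv : ℕ → ℚ
inv zero = ℚ.0ℚ
inv (suc m) = (+ 1) ℚ./ suc m

prodFrom : ℕ → ℕ → (ℕ → ℚ) → ℚ
prodFrom a zero f = ℚ.1ℚ
prodFrom a (suc b) f = if does (a ℕ.≤? suc b) then prodFrom a b f ℚ.* f (suc b) else prodFrom a b f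

factorC1 : ℕ → ℕ → ℚ
factorC1 (suc zero) p = ℚ.1ℚ
factorC1 k p = ℚ.1ℚ ℚ.- inv p ℚ.* (ℚ.1ℚ ℚ.- prodFrom 2 k (λ i → ℚ.1ℚ ℚ.- inv (p ℕ.^ i)))

factorC2 : ℕ → ℕ → ℚ
factorC2 (suc zero) p = ℚ.1ℚ ℚ.- inv (p ℕ.^ 2)
factorC2 k p = ℚ.1ℚ ℚ.- inv p ℚ.* (ℚ.1ℚ ℚ.- prodFrom 1 k (λ i → ℚ.1ℚ ℚ.- inv (p ℕ.^ i)))

primeProd : (ℕ → ℚ) → ℕ → ℚ
primeProd g zero = ℚ.1ℚ
primeProd g (suc M) = if does (prime? (suc M)) then primeProd g M ℚ.* g (suc M) else primeProd g M

-- "(x_n) is Cesàro equivalent to (C · y_n)", where C = lim_{M→∞} P M is an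
-- infinite product given by its partial products P M (all rational):
-- for every ε > 0 there is N such that for every n ≥ N, for all sufficiently
-- large M, | Σ_{m≤n} x_m − P M · Σ_{m≤n} y_m | ≤ ε · P M · Σ_{m≤n} y_m.
CesaroEquivProd : (x : ℕ → ℕ) (P : ℕ → ℚ) (y : ℕ → ℕ) → Set
CesaroEquivProd x P y =
  (ε : ℚ) → ℚ.0ℚ ℚ.< ε →
  Σ ℕ λ N → (n : ℕ) → N ℕ.≤ n →
  Σ ℕ λ M₀ → (M : ℕ) → M₀ ℕ.≤ M →
  ℚ.∣ qN (sumTo x n) ℚ.- P M ℚ.* qN (sumTo y n) ∣
    ℚ.≤ ε ℚ.* P M ℚ.* qN (sumTo y n)
  where open import Data.Product using (Σ)

module Submission where

-- Counting.  A first row v of a k × k matrix modulo n can be brought to (gcd v, 0, …, 0) by adding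
-- multiples of a column to an adjacent one, and to (1, 0, …, 0) when gcd(v, n) = 1 and k ≥ 2.  Hence
-- #SL_k = n^(k-1) · J_k(n) · #SL_(k-1), and likewise for GL, where the Jordan totient J_k(n) counts
-- the vectors with gcd(v, n) = 1.  Sieving these vectors prime by prime gives
-- J_k(n) = n^k ∏_{p ∣ n} (1 - p^(-k)), so both sequences have the form n^K ∏_{p ∣ n} f(p) with
-- 0 ≤ 1 - f(p) ≤ 1/(p-1).
--
-- Mean value.  Let A_L(n) be the sum over m ≤ n of ∏_{p ∣ m, p ≤ L} f(p), and
-- P_L = ∏_{p ≤ L} (1 - (1 - f(p))/p).  For a prime p = L + 1, A_p(n) = A_L(n) - (1 - f(p)) A_L(⌊n/p⌋),
-- and P_L satisfies the same recursion with division by p in place of ⌊n/p⌋.  Therefore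
-- |A_L(n) - P_L n| stays below a constant depending on L only, while A_L(n)/n and P_L both decrease
-- by at most 1/L beyond L.  Abel summation brings in the weights n^K.

open import Defs
open import Data.Bool using (Bool; true; false; if_then_else_)
open import Data.Fin using (Fin; zero; suc; toℕ; punchIn; punchOut)
open import Data.Fin.Properties using (_≟_; punchIn-injective; punchIn-punchOut; punchInᵢ≢i)
open import Data.Integer as ℤ using (ℤ; +_; -[1+_]; +[1+_]; +0)
open import Data.Integer.DivMod using (_%ℕ_; _/ℕ_; n%ℕd<d; a≡a%ℕn+[a/ℕn]*n)
import Data.Integer.Properties as ℤₚ
open import Data.Integer.Tactic.RingSolver using () renaming (solve-∀ to ℤ-solve-∀)
open import Data.List as List using (List; _++_; map; foldr; concatMap; filter; length; tabulate; allFin)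
import Data.List.Relation.Unary.All as All
open import Data.Maybe using (Maybe; just; nothing)
open import Data.Nat as ℕ using (ℕ; zero; suc; NonZero)
open import Data.Nat.Coprimality using (coprime-Bézout; gcd≡1⇒coprime)
open import Data.Nat.Divisibility using (_∣?_; divides; ∣-trans; ∣⇒≤; >⇒∤; ∣1⇒≡1; ∣m⇒∣m*n; n∣m*n; m∣m*n; %-presˡ-∣; ∣n∣m%n⇒∣m) renaming (_∣_ to _∣ₙ_)
open import Data.Nat.DivMod using (m/n*n≤m; m≡m%n+[m/n]*n; m%n<n; m<n⇒m%n≡m)
open import Data.Nat.GCD using (gcd; gcd-identityˡ; gcd-identityʳ; gcd-comm; gcd-GCD; module GCD; module Bézout; gcd-greatest; gcd[m,n]∣m; gcd[m,n]∣n; gcd[m,n]≢0; gcd-universality; c*gcd[m,n]≡gcd[cm,cn])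
open import Data.Nat.ListAction using (product)
open import Data.Nat.Primality using (Prime; prime?; ¬prime[0]; ¬prime[1]; prime[2]; prime⇒irreducible; euclidsLemma)
open import Data.Nat.Primality.Factorisation using (factorise)
import Data.Nat.Properties as ℕₚ
open import Data.Nat.Tactic.RingSolver using () renaming (solve-∀ to ℕ-solve-∀)
open import Data.Product using (Σ; _×_; _,_; proj₁; proj₂)
open import Data.Rational as ℚ using (ℚ; 0ℚ; 1ℚ; _+_; _*_; _-_; -_; _≤_; _<_; ∣_∣; toℚᵘ)
import Data.Rational.Properties as ℚₚ
open import Data.Rational.Unnormalised as ℚᵘ using (mkℚᵘ; *≡*; *≤*)
import Data.Rational.Unnormalised.Properties as ℚᵘₚ
open import Data.Sum using (inj₁; inj₂)
open import Data.Vec.Functional using (_∷_)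
open import Function using (_∘_; id; mk⇔)
open import Level using (0ℓ)
open import Relation.Binary.PropositionalEquality
open import Relation.Nullary using (¬_; Dec; yes; no; does; contradiction)
open import Relation.Nullary.Decidable using (_×-dec_; dec-true; dec-false; does-⇔)
open import Tactic.RingSolver using () renaming (solve-∀ to ring-solve-∀)
open import Tactic.RingSolver.Core.AlmostCommutativeRing using (AlmostCommutativeRing; fromCommutativeRing)

-- Determinants modulo n and column operations

-- ℤ/nℤ is not a domain, so row reduction is done on integer representatives, and what is reduced is
-- not a matrix but the number of completions of a first row. If the gcd g of the row has a factor
-- in common with n, every completion has determinant a multiple of g, so none is counted.
--
-- The limit of the products is never formed: a sum up to n is compared with a product up to an
-- arbitrary large M, and a third cut-off L links the two. L is chosen from ε and the exponent; then
-- n must be large against L and its error constant, while M only has to exceed L. Adding one prime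
-- at a time gives recursions that hold for all n at once.
--
-- The bound 1 - f(p) ≤ 1/(p-1) has this form because the loss at p is then at most 1/((p-1)p) =
-- 1/(p-1) - 1/p. Summed over all integers in place of the primes, such losses telescope. Since the
-- allowed error is relative to the product itself, the products must also stay above a positive
-- constant, and the same telescoping supplies 1/4.

module Congruence (n : ℕ) where

  infix 4 _≈_
  -- The quotient is explicit so that, after matching on the equations, each closure property
  -- becomes a ring identity.
  record _≈_ (a b : ℤ) : Set where
    constructor congruent
    field
      quot : ℤ
      eq   : a ≡ b ℤ.+ quot ℤ.* + n

  ≈-reflexive : ∀ {a b} → a ≡ b → a ≈ b
  ≈-reflexive {a} refl = congruent (+ 0) (sym (ℤₚ.+-identityʳ a))

  ≈-refl : ∀ {a} → a ≈ a
  ≈-refl = ≈-reflexive refl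

  ≈-sym : ∀ {a b} → a ≈ b → b ≈ a
  ≈-sym {b = b} (congruent q refl) = congruent (ℤ.- q) (lemma b q (+ n))
    where
    lemma : ∀ b q n → b ≡ b ℤ.+ q ℤ.* n ℤ.+ ℤ.- q ℤ.* n
    lemma = ℤ-solve-∀

  ≈-trans : ∀ {a b c} → a ≈ b → b ≈ c → a ≈ c
  ≈-trans {c = c} (congruent q refl) (congruent r refl) = congruent (r ℤ.+ q) (lemma c q r (+ n))
    where
    lemma : ∀ c q r n → c ℤ.+ r ℤ.* n ℤ.+ q ℤ.* n ≡ c ℤ.+ (r ℤ.+ q) ℤ.* n
    lemma = ℤ-solve-∀

  +-cong : ∀ {a b c d} → a ≈ b → c ≈ d → a ℤ.+ c ≈ b ℤ.+ d
  +-cong {b = b} {d = d} (congruent q refl) (congruent r refl) = congruent (q ℤ.+ r) (lemma b d q r (+ n))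
    where
    lemma : ∀ b d q r n → b ℤ.+ q ℤ.* n ℤ.+ (d ℤ.+ r ℤ.* n) ≡ b ℤ.+ d ℤ.+ (q ℤ.+ r) ℤ.* n
    lemma = ℤ-solve-∀

  *-cong : ∀ {a b c d} → a ≈ b → c ≈ d → a ℤ.* c ≈ b ℤ.* d
  *-cong {b = b} {d = d} (congruent q refl) (congruent r refl) =
    congruent (b ℤ.* r ℤ.+ q ℤ.* d ℤ.+ q ℤ.* r ℤ.* + n) (lemma b d q r (+ n))
    where
    lemma : ∀ b d q r n → (b ℤ.+ q ℤ.* n) ℤ.* (d ℤ.+ r ℤ.* n) ≡ b ℤ.* d ℤ.+ (b ℤ.* r ℤ.+ q ℤ.* d ℤ.+ q ℤ.* r ℤ.* n) ℤ.* n
    lemma = ℤ-solve-∀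

  +-congˡ : ∀ a {b c} → b ≈ c → a ℤ.+ b ≈ a ℤ.+ c
  +-congˡ a = +-cong (≈-refl {a})

  *-congˡ : ∀ a {b c} → b ≈ c → a ℤ.* b ≈ a ℤ.* c
  *-congˡ a = *-cong (≈-refl {a})

  infixr 2 _▸_ _▹_
  _▸_ : ∀ {a b c} → a ≈ b → b ≈ c → a ≈ c
  _▸_ = ≈-trans

  _▹_ : ∀ {a b c} → a ≡ b → b ≈ c → a ≈ c
  refl ▹ q = q

ΣFin : ∀ {k} → (Fin k → ℤ) → ℤ
ΣFin {zero}  u = + 0
ΣFin {suc k} u = u zero ℤ.+ ΣFin (u ∘ suc)

foldr-tabulate : ∀ {k} {A : Set} (g : A → ℤ) (h : Fin k → A) →
  foldr ℤ._+_ (+ 0) (map g (tabulate h)) ≡ ΣFin (g ∘ h)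
foldr-tabulate {zero}  g h = refl
foldr-tabulate {suc k} g h = cong (ℤ._+_ (g (h zero))) (foldr-tabulate g (h ∘ suc))

ΣFin-linear : ∀ {k} (c : ℤ) (u v : Fin k → ℤ) →
  ΣFin (λ j → u j ℤ.+ c ℤ.* v j) ≡ ΣFin u ℤ.+ c ℤ.* ΣFin v
ΣFin-linear {zero}  c u v = sym (trans (ℤₚ.+-identityˡ _) (ℤₚ.*-zeroʳ c))
ΣFin-linear {suc k} c u v rewrite ΣFin-linear c (u ∘ suc) (v ∘ suc) =
  lemma c (u zero) (v zero) (ΣFin (u ∘ suc)) (ΣFin (v ∘ suc))
  where
  lemma : ∀ c a b x y → a ℤ.+ c ℤ.* b ℤ.+ (x ℤ.+ c ℤ.* y) ≡ a ℤ.+ x ℤ.+ c ℤ.* (b ℤ.+ y)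
  lemma = ℤ-solve-∀

minor : ∀ {A k} → Matrix A (suc k) → Fin (suc k) → Matrix A k
minor M b i j = M (suc i) (punchIn b j)

laplaceTerm : ∀ {k} → Matrix ℤ (suc k) → Fin (suc k) → ℤ
laplaceTerm M b = sgn (toℕ b) ℤ.* M zero b ℤ.* det (minor M b)

det-expand : ∀ {k} (M : Matrix ℤ (suc k)) → det M ≡ ΣFin (laplaceTerm M)
det-expand M = foldr-tabulate (laplaceTerm M) id

-- Source and target of a column operation. Adjacency suits the Laplace expansion along the first
-- row: deleting a third column leaves the two adjacent, and their own terms carry opposite signs.
-- Euclid's algorithm, run along a row from its right end, needs neighbouring columns only.
data Adjacent : ∀ {k} → Fin (suc k) → Fin (suc k) → Set where
  right : ∀ {k} → Adjacent {suc k} zero (suc zero)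
  left  : ∀ {k} → Adjacent {suc k} (suc zero) zero
  shift : ∀ {k} {s t : Fin (suc k)} → Adjacent s t → Adjacent (suc s) (suc t)

sgn-adjacent : ∀ {k} {s t : Fin (suc k)} → Adjacent s t → sgn (toℕ t) ≡ ℤ.- sgn (toℕ s)
sgn-adjacent right     = refl
sgn-adjacent left      = refl
sgn-adjacent (shift a) = cong ℤ.-_ (sgn-adjacent a)

-- Deleting either of two neighbours leaves the other in the same place r, so the minors at s and t
-- differ in column r only.
minor-position : ∀ {k} {s t : Fin (suc k)} → Adjacent s t →
  Σ (Fin k) λ r → punchIn s r ≡ t × punchIn t r ≡ s × (∀ j → j ≢ r → punchIn t j ≡ punchIn s j)
minor-position right = zero , refl , refl , λ { zero j≢ → contradiction refl j≢ ; (suc j) _ → refl }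
minor-position left  = zero , refl , refl , λ { zero j≢ → contradiction refl j≢ ; (suc j) _ → refl }
minor-position (shift {zero} a) with minor-position a
... | () , _
minor-position (shift {suc k} a) with minor-position a
... | r , p , q , same = suc r , cong suc p , cong suc q ,
      λ { zero _ → refl ; (suc j) j≢ → cong suc (same j (j≢ ∘ cong suc)) }

minor-adjacent : ∀ {k} (b : Fin (suc (suc k))) {s t : Fin (suc (suc k))} → Adjacent s t → b ≢ s → b ≢ t →
  Σ (Fin (suc k)) λ s′ → Σ (Fin (suc k)) λ t′ → punchIn b s′ ≡ s × punchIn b t′ ≡ t × Adjacent s′ t′
minor-adjacent zero right b≢s b≢t = contradiction refl b≢s
minor-adjacent zero left  b≢s b≢t = contradiction refl b≢t
minor-adjacent zero (shift a) _ _ = _ , _ , refl , refl , a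
minor-adjacent (suc zero) right b≢s b≢t = contradiction refl b≢t
minor-adjacent (suc zero) left  b≢s b≢t = contradiction refl b≢s
minor-adjacent {suc k} (suc (suc b)) right _ _ = zero , suc zero , refl , refl , right
minor-adjacent {suc k} (suc (suc b)) left  _ _ = suc zero , zero , refl , refl , left
minor-adjacent {zero} (suc b) (shift a) _ _ with minor-position a
... | () , _
minor-adjacent {suc k} (suc b) (shift a) b≢s b≢t with minor-adjacent b a (b≢s ∘ cong suc) (b≢t ∘ cong suc)
... | s′ , t′ , p , q , a′ = suc s′ , suc t′ , cong suc p , cong suc q , shift a′

module Determinant (n : ℕ) where
  open Congruence n

  ΣFin-cong : ∀ {k} {u v : Fin k → ℤ} → (∀ j → u j ≈ v j) → ΣFin u ≈ ΣFin v
  ΣFin-cong {zero}  u≈v = ≈-refl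
  ΣFin-cong {suc k} u≈v = +-cong (u≈v zero) (ΣFin-cong (u≈v ∘ suc))

  -- A column operation changes the Laplace terms at s and t individually and preserves only their
  -- sum.
  ΣFin-adjacent : ∀ {k} {u v : Fin (suc k) → ℤ} {s t} → Adjacent s t →
    (∀ j → j ≢ s → j ≢ t → u j ≈ v j) → u s ℤ.+ u t ≈ v s ℤ.+ v t → ΣFin u ≈ ΣFin v
  ΣFin-adjacent {u = u} {v} right same st =
    sym (ℤₚ.+-assoc (u zero) _ _) ▹
    +-cong st (ΣFin-cong λ j → same (suc (suc j)) (λ ()) (λ ())) ▸
    ≈-reflexive (ℤₚ.+-assoc (v zero) _ _)
  ΣFin-adjacent {u = u} {v} left same st =
    lemma (u zero) (u (suc zero)) _ ▹
    +-cong st (ΣFin-cong λ j → same (suc (suc j)) (λ ()) (λ ())) ▸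
    ≈-reflexive (sym (lemma (v zero) (v (suc zero)) _))
    where
    lemma : ∀ a b x → a ℤ.+ (b ℤ.+ x) ≡ b ℤ.+ a ℤ.+ x
    lemma = ℤ-solve-∀
  ΣFin-adjacent (shift a) same st =
    +-cong (same zero (λ ()) (λ ()))
      (ΣFin-adjacent a (λ j j≢s j≢t → same (suc j) (λ { refl → j≢s refl }) (λ { refl → j≢t refl })) st)

  laplace-cong : ∀ σ {x y d e} → x ≈ y → d ≈ e → σ ℤ.* x ℤ.* d ≈ σ ℤ.* y ℤ.* e
  laplace-cong σ x≈y d≈e = *-cong (*-congˡ σ x≈y) d≈e

  det-cong : ∀ {k} {M N : Matrix ℤ k} → (∀ i j → M i j ≈ N i j) → det M ≈ det N
  det-cong {zero} M≈N = ≈-refl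
  det-cong {suc k} {M} {N} M≈N =
    det-expand M ▹
    ΣFin-cong (λ b → laplace-cong (sgn (toℕ b)) (M≈N zero b) (det-cong λ i j → M≈N (suc i) (punchIn b j))) ▸
    ≈-reflexive (sym (det-expand N))

  -- In the Laplace term at t the entry is linear and the minors agree; in any other term the minor
  -- is linear by induction. Relating three given matrices by hypotheses, instead of updating a
  -- column, makes the minors satisfy the same hypotheses.
  det-linear : ∀ {k} (t : Fin k) (c : ℤ) (A B C : Matrix ℤ k) →
    (∀ i j → j ≢ t → A i j ≈ B i j) → (∀ i j → j ≢ t → C i j ≈ B i j) →
    (∀ i → A i t ≈ B i t ℤ.+ c ℤ.* C i t) → det A ≈ det B ℤ.+ c ℤ.* det C
  det-linear {suc k} t c A B C A≈B C≈B At =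
    det-expand A ▹ ΣFin-cong term ▸
    ≈-reflexive (trans (ΣFin-linear c (laplaceTerm B) (laplaceTerm C))
                       (sym (cong₂ (λ x y → x ℤ.+ c ℤ.* y) (det-expand B) (det-expand C))))
    where
    at : ∀ σ x y c d → σ ℤ.* (x ℤ.+ c ℤ.* y) ℤ.* d ≡ σ ℤ.* x ℤ.* d ℤ.+ c ℤ.* (σ ℤ.* y ℤ.* d)
    at = ℤ-solve-∀
    off : ∀ σ x y c d → σ ℤ.* x ℤ.* (y ℤ.+ c ℤ.* d) ≡ σ ℤ.* x ℤ.* y ℤ.+ c ℤ.* (σ ℤ.* x ℤ.* d)
    off = ℤ-solve-∀
    term : ∀ b → laplaceTerm A b ≈ laplaceTerm B b ℤ.+ c ℤ.* laplaceTerm C b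
    term b with b ≟ t
    ... | yes refl =
      laplace-cong (sgn (toℕ b)) (At zero) (det-cong λ i j → A≈B (suc i) _ (punchInᵢ≢i b j)) ▸
      at (sgn (toℕ b)) (B zero b) (C zero b) c (det (minor B b)) ▹
      +-congˡ (laplaceTerm B b) (*-congˡ c (*-congˡ (sgn (toℕ b) ℤ.* C zero b)
        (det-cong λ i j → ≈-sym (C≈B (suc i) _ (punchInᵢ≢i b j)))))
    ... | no b≢t =
      laplace-cong (sgn (toℕ b)) (A≈B zero b b≢t) (det-linear t′ c (minor A b) (minor B b) (minor C b)
        (λ i j j≢ → A≈B (suc i) _ (away j j≢)) (λ i j j≢ → C≈B (suc i) _ (away j j≢))
        (λ i → subst (λ x → A (suc i) x ≈ B (suc i) x ℤ.+ c ℤ.* C (suc i) x) (sym (punchIn-punchOut b≢t)) (At (suc i)))) ▸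
      off (sgn (toℕ b)) (B zero b) (det (minor B b)) c (det (minor C b)) ▹
      +-congˡ (laplaceTerm B b) (*-congˡ c (laplace-cong (sgn (toℕ b)) (≈-sym (C≈B zero b b≢t))
        (≈-refl {det (minor C b)})))
      where
      t′ = punchOut b≢t
      away : ∀ j → j ≢ t′ → punchIn b j ≢ t
      away j j≢ p = j≢ (punchIn-injective b j t′ (trans p (sym (punchIn-punchOut b≢t))))

  -- A relation modulo n instead of a function on rows: it passes to minors and to prefixed rows
  -- without any equality between functions.
  record ColumnOp {k} (s t : Fin k) (c : ℤ) (v w : Fin k → ℤ) : Set where
    field
      off : ∀ j → j ≢ t → w j ≈ v j
      at  : w t ≈ v t ℤ.+ c ℤ.* v s
  open ColumnOp public

  -- Only the Laplace terms at s and t change, by opposite multiples of the minor at t, since the minor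
  -- at s is linear in its copy of column t.
  det-columnOp : ∀ {k} {s t : Fin (suc k)} → Adjacent s t → ∀ c {B A : Matrix ℤ (suc k)} →
    (∀ i → ColumnOp s t c (B i) (A i)) → det A ≈ det B
  det-columnOp {zero} a with minor-position a
  ... | () , _
  det-columnOp {suc k} {s} {t} a c {B} {A} op =
    det-expand A ▹ ΣFin-adjacent a other main ▸ ≈-reflexive (sym (det-expand B))
    where
    s≢t : ∀ {k} {s t : Fin (suc k)} → Adjacent s t → s ≢ t
    s≢t (shift a) refl = s≢t a refl
    other : ∀ b → b ≢ s → b ≢ t → laplaceTerm A b ≈ laplaceTerm B b
    other b b≢s b≢t with minor-adjacent b a b≢s b≢t
    ... | s′ , t′ , refl , refl , a′ =
      laplace-cong (sgn (toℕ b)) (off (op zero) b b≢t)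
        (det-columnOp a′ c λ i → record
          { off = λ j j≢ → off (op (suc i)) _ λ p → j≢ (punchIn-injective b j t′ p)
          ; at  = at (op (suc i)) })
    cancel : ∀ σ x y c D E → σ ℤ.* x ℤ.* (D ℤ.+ c ℤ.* E) ℤ.+ ℤ.- σ ℤ.* (y ℤ.+ c ℤ.* x) ℤ.* E ≡ σ ℤ.* x ℤ.* D ℤ.+ ℤ.- σ ℤ.* y ℤ.* E
    cancel = ℤ-solve-∀
    main : laplaceTerm A s ℤ.+ laplaceTerm A t ≈ laplaceTerm B s ℤ.+ laplaceTerm B t
    main with minor-position a
    ... | r , refl , q , same rewrite sgn-adjacent a =
      +-cong
        (laplace-cong (sgn (toℕ s)) (off (op zero) s (s≢t a))
          (det-linear r c (minor A s) (minor B s) (minor B t)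
            (λ i j j≢ → off (op (suc i)) _ λ p → j≢ (punchIn-injective s j r p))
            (λ i j j≢ → ≈-reflexive (cong (B (suc i)) (same j j≢)))
            (λ i → at (op (suc i)) ▸ ≈-reflexive (cong (λ x → B (suc i) t ℤ.+ c ℤ.* B (suc i) x) (sym q)))))
        (laplace-cong (ℤ.- sgn (toℕ s)) (at (op zero)) (det-cong λ i j → off (op (suc i)) _ (punchInᵢ≢i t j))) ▸
      ≈-reflexive (cancel (sgn (toℕ s)) (B zero s) (B zero t) c (det (minor B s)) (det (minor B t)))

-- Matrix sums over the residues modulo n

indicator : ∀ {P : Set} → Dec P → ℕ
indicator P? = if does P? then 1 else 0

indicator-true : ∀ {P : Set} (P? : Dec P) → P → indicator P? ≡ 1
indicator-true (yes _) _ = refl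
indicator-true (no ¬p) p = contradiction p ¬p

indicator-false : ∀ {P : Set} (P? : Dec P) → ¬ P → indicator P? ≡ 0
indicator-false (yes p) ¬p = contradiction p ¬p
indicator-false (no _)  _  = refl

-- These laws are inherited by `sumFun`, so one record serves sums over entries, rows and matrices.
-- Congruence is a field because summands are equal only pointwise.
record IsSum {A : Set} (S : (A → ℕ) → ℕ) : Set where
  field
    ∑-cong : ∀ {f g} → (∀ a → f a ≡ g a) → S f ≡ S g
    ∑-+    : ∀ f g → S (λ a → f a ℕ.+ g a) ≡ S f ℕ.+ S g
    ∑-*    : ∀ c f → S (λ a → c ℕ.* f a) ≡ c ℕ.* S f
  ∑-zero : S (λ _ → 0) ≡ 0
  ∑-zero = ∑-* 0 (λ _ → 0)
open IsSum

sumTo-cong : ∀ {f g : ℕ → ℕ} → (∀ a → f a ≡ g a) → ∀ n → sumTo f n ≡ sumTo g n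
sumTo-cong f≡g zero    = refl
sumTo-cong f≡g (suc n) = cong₂ ℕ._+_ (sumTo-cong f≡g n) (f≡g (suc n))

sumTo-isSum : ∀ n → IsSum (λ f → sumTo f n)
sumTo-isSum n = record { ∑-cong = λ p → sumTo-cong p n ; ∑-+ = plus n ; ∑-* = times n }
  where
  lemma : ∀ a b x y → a ℕ.+ b ℕ.+ (x ℕ.+ y) ≡ a ℕ.+ x ℕ.+ (b ℕ.+ y)
  lemma = ℕ-solve-∀
  plus : ∀ n f g → sumTo (λ a → f a ℕ.+ g a) n ≡ sumTo f n ℕ.+ sumTo g n
  plus zero    f g = refl
  plus (suc n) f g rewrite plus n f g = lemma (sumTo f n) (sumTo g n) (f (suc n)) (g (suc n))
  times : ∀ n c f → sumTo (λ a → c ℕ.* f a) n ≡ c ℕ.* sumTo f n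
  times zero    c f = sym (ℕₚ.*-zeroʳ c)
  times (suc n) c f rewrite times n c f = sym (ℕₚ.*-distribˡ-+ c (sumTo f n) (f (suc n)))

sumTo-swap : ∀ (f : ℕ → ℕ → ℕ) m n → sumTo (λ a → sumTo (f a) m) n ≡ sumTo (λ b → sumTo (λ a → f a b) n) m
sumTo-swap f m zero    = sym (∑-zero (sumTo-isSum m))
sumTo-swap f m (suc n) rewrite sumTo-swap f m n =
  sym (∑-+ (sumTo-isSum m) (λ b → sumTo (λ a → f a b) n) (f (suc n)))

sumTo-const : ∀ c n → sumTo (λ _ → c) n ≡ n ℕ.* c
sumTo-const c zero    = refl
sumTo-const c (suc n) = trans (cong (ℕ._+ c) (sumTo-const c n)) (ℕₚ.+-comm (n ℕ.* c) c)

sumTo-shift : ∀ (g : ℕ → ℕ) n → sumTo (g ∘ suc) n ℕ.+ g 1 ≡ sumTo g n ℕ.+ g (suc n)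
sumTo-shift g zero    = refl
sumTo-shift g (suc n) = begin
  sumTo (g ∘ suc) n ℕ.+ g (suc (suc n)) ℕ.+ g 1   ≡⟨ lemma (sumTo (g ∘ suc) n) (g (suc (suc n))) (g 1) ⟩
  sumTo (g ∘ suc) n ℕ.+ g 1 ℕ.+ g (suc (suc n))   ≡⟨ cong (ℕ._+ g (suc (suc n))) (sumTo-shift g n) ⟩
  sumTo g n ℕ.+ g (suc n) ℕ.+ g (suc (suc n))     ∎
  where
  open ≡-Reasoning
  lemma : ∀ a b c → a ℕ.+ b ℕ.+ c ≡ a ℕ.+ c ℕ.+ b
  lemma = ℕ-solve-∀

sumFun : ∀ {A : Set} → ((A → ℕ) → ℕ) → ∀ k → ((Fin k → A) → ℕ) → ℕ
sumFun S zero    φ = φ (λ ())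
sumFun S (suc k) φ = S (λ a → sumFun S k (λ f → φ (a ∷ f)))

sumFun-isSum : ∀ {A : Set} {S : (A → ℕ) → ℕ} → IsSum S → ∀ k → IsSum (sumFun S k)
sumFun-isSum {S = S} s k = record { ∑-cong = same k ; ∑-+ = plus k ; ∑-* = times k }
  where
  same : ∀ k {f g} → (∀ a → f a ≡ g a) → sumFun S k f ≡ sumFun S k g
  same zero    f≡g = f≡g _
  same (suc k) f≡g = ∑-cong s λ a → same k (λ v → f≡g (a ∷ v))
  plus : ∀ k f g → sumFun S k (λ a → f a ℕ.+ g a) ≡ sumFun S k f ℕ.+ sumFun S k g
  plus zero    f g = refl
  plus (suc k) f g = trans (∑-cong s λ a → plus k (λ v → f (a ∷ v)) (λ v → g (a ∷ v))) (∑-+ s _ _)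
  times : ∀ k c f → sumFun S k (λ a → c ℕ.* f a) ≡ c ℕ.* sumFun S k f
  times zero    c f = refl
  times (suc k) c f = trans (∑-cong s λ a → times k c (λ v → f (a ∷ v))) (∑-* s c _)

-- The representatives are 1, …, n rather than 0, …, n - 1; periodic summands do not see the difference.
residueSum : ℕ → (ℤ → ℕ) → ℕ
residueSum n f = sumTo (λ a → f (+ a)) n

residueSum-isSum : ∀ n → IsSum (residueSum n)
residueSum-isSum n = record
  { ∑-cong = λ f≡g → ∑-cong (sumTo-isSum n) λ a → f≡g (+ a)
  ; ∑-+ = λ f g → ∑-+ (sumTo-isSum n) _ _
  ; ∑-* = λ c f → ∑-* (sumTo-isSum n) c _ }

rowSum : ℕ → ∀ k → ((Fin k → ℤ) → ℕ) → ℕ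
rowSum n = sumFun (residueSum n)

rowSum-isSum : ∀ n k → IsSum (rowSum n k)
rowSum-isSum n = sumFun-isSum (residueSum-isSum n)

matrixSum : ℕ → ∀ r k → ((Fin r → Fin k → ℤ) → ℕ) → ℕ
matrixSum n r k = sumFun (rowSum n k) r

matrixSum-isSum : ∀ n r k → IsSum (matrixSum n r k)
matrixSum-isSum n r k = sumFun-isSum (rowSum-isSum n k) r

-- `gcdVec` sees absolute values only and Euclid's algorithm runs on ℕ; the rows that `rowSum`
-- ranges over have entries of this kind.
NonNegative : ∀ {k} → (Fin k → ℤ) → Set
NonNegative v = ∀ i → v i ≡ + ℤ.∣ v i ∣

rowSum-cong : ∀ n k {φ ψ : (Fin k → ℤ) → ℕ} → (∀ v → NonNegative v → φ v ≡ ψ v) → rowSum n k φ ≡ rowSum n k ψ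
rowSum-cong n zero    φ≡ψ = φ≡ψ _ λ ()
rowSum-cong n (suc k) φ≡ψ = sumTo-cong (λ a → rowSum-cong n k λ v v≥0 →
  φ≡ψ (+ a ∷ v) λ { zero → refl ; (suc i) → v≥0 i }) n

rowSum-const : ∀ n k c → rowSum n k (λ _ → c) ≡ n ℕ.^ k ℕ.* c
rowSum-const n zero    c = sym (ℕₚ.+-identityʳ c)
rowSum-const n (suc k) c = begin
  sumTo (λ _ → rowSum n k (λ _ → c)) n   ≡⟨ sumTo-cong (λ _ → rowSum-const n k c) n ⟩
  sumTo (λ _ → n ℕ.^ k ℕ.* c) n          ≡⟨ sumTo-const _ n ⟩
  n ℕ.* (n ℕ.^ k ℕ.* c)                  ≡⟨ ℕₚ.*-assoc n (n ℕ.^ k) c ⟨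
  n ℕ.^ suc k ℕ.* c                      ∎
  where open ≡-Reasoning

-- Reducing a row to its gcd by column operations

gcdVec : ∀ {k} → (Fin k → ℤ) → ℕ
gcdVec {zero}  v = 0
gcdVec {suc k} v = gcd ℤ.∣ v zero ∣ (gcdVec (v ∘ suc))

firstOnly : ∀ {k} → ℤ → Fin (suc k) → ℤ
firstOnly g = g ∷ λ _ → + 0

gcd-+ : ∀ m k → gcd m (m ℕ.+ k) ≡ gcd m k
gcd-+ m k = GCD.unique (gcd-GCD m (m ℕ.+ k)) (GCD.step (gcd-GCD m k))

module Euclid (H : ℤ → ℤ → ℕ)
  (addˡ : ∀ a b c → H a (b ℤ.+ c ℤ.* a) ≡ H a b) (addʳ : ∀ a b c → H (a ℤ.+ c ℤ.* b) b ≡ H a b) where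

  open ≡-Reasoning

  -- Subtractive Euclid on two neighbouring columns. The fuel bounds a + b, which drops at every
  -- subtraction because the number subtracted is positive.
  euclid : ∀ fuel a b → a ℕ.+ b ℕ.≤ fuel → H (+ a) (+ b) ≡ H (+ gcd a b) (+ 0)
  -- Columns cannot be exchanged, so b is copied to the left and then cleared on the right.
  euclid fuel zero b _ = begin
    H (+ 0) (+ b)                     ≡⟨ addʳ (+ 0) (+ b) (+ 1) ⟨
    H (+ 0 ℤ.+ + 1 ℤ.* + b) (+ b)     ≡⟨ cong (λ x → H x (+ b)) (trans (ℤₚ.+-identityˡ _) (ℤₚ.*-identityˡ (+ b))) ⟩
    H (+ b) (+ b)                     ≡⟨ cong (H (+ b)) (trans (ℤₚ.+-identityˡ _) (ℤₚ.*-identityˡ (+ b))) ⟨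
    H (+ b) (+ 0 ℤ.+ + 1 ℤ.* + b)     ≡⟨ addˡ (+ b) (+ 0) (+ 1) ⟩
    H (+ b) (+ 0)                     ≡⟨ cong (λ x → H (+ x) (+ 0)) (gcd-identityˡ b) ⟨
    H (+ gcd 0 b) (+ 0)               ∎
  euclid fuel (suc a) zero _ = cong (λ x → H (+ x) (+ 0)) (sym (gcd-identityʳ (suc a)))
  euclid (suc fuel) (suc a) (suc b) (ℕ.s≤s le) with ℕₚ.≤-total (suc a) (suc b)
  ... | inj₁ a≤b with k , refl ← ℕₚ.m≤n⇒∃[o]m+o≡n a≤b = begin
    H (+ suc a) (+ (suc a ℕ.+ k))
      ≡⟨ cong (H (+ suc a)) (trans (cong +_ (ℕₚ.+-comm (suc a) k)) (cong (ℤ._+_ (+ k)) (sym (ℤₚ.*-identityˡ (+ suc a))))) ⟩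
    H (+ suc a) (+ k ℤ.+ + 1 ℤ.* + suc a)     ≡⟨ addˡ (+ suc a) (+ k) (+ 1) ⟩
    H (+ suc a) (+ k)                         ≡⟨ euclid fuel (suc a) k (ℕₚ.≤-trans (ℕₚ.m≤n+m (suc a ℕ.+ k) a) le) ⟩
    H (+ gcd (suc a) k) (+ 0)                 ≡⟨ cong (λ x → H (+ x) (+ 0)) (gcd-+ (suc a) k) ⟨
    H (+ gcd (suc a) (suc a ℕ.+ k)) (+ 0)     ∎
  ... | inj₂ b≤a with k , refl ← ℕₚ.m≤n⇒∃[o]m+o≡n b≤a = begin
    H (+ (suc b ℕ.+ k)) (+ suc b)
      ≡⟨ cong (λ x → H x (+ suc b)) (trans (cong +_ (ℕₚ.+-comm (suc b) k)) (cong (ℤ._+_ (+ k)) (sym (ℤₚ.*-identityˡ (+ suc b))))) ⟩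
    H (+ k ℤ.+ + 1 ℤ.* + suc b) (+ suc b)     ≡⟨ addʳ (+ k) (+ suc b) (+ 1) ⟩
    H (+ k) (+ suc b)
      ≡⟨ euclid fuel k (suc b) (ℕₚ.≤-trans (ℕₚ.+-monoˡ-≤ (suc b) (ℕₚ.m≤n+m k b)) le) ⟩
    H (+ gcd k (suc b)) (+ 0)                 ≡⟨ cong (λ x → H (+ x) (+ 0)) (gcd-comm k (suc b)) ⟩
    H (+ gcd (suc b) k) (+ 0)                 ≡⟨ cong (λ x → H (+ x) (+ 0)) (gcd-+ (suc b) k) ⟨
    H (+ gcd (suc b) (suc b ℕ.+ k)) (+ 0)     ≡⟨ cong (λ x → H (+ x) (+ 0)) (gcd-comm (suc b) (suc b ℕ.+ k)) ⟩
    H (+ gcd (suc b ℕ.+ k) (suc b)) (+ 0)     ∎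

det-firstOnly : ∀ {k} g (R : Fin k → Fin (suc k) → ℤ) → det (firstOnly g ∷ R) ≡ g ℤ.* det (λ i j → R i (suc j))
det-firstOnly g R = trans (det-expand (firstOnly g ∷ R))
  (trans (cong₂ ℤ._+_ (cong (ℤ._* det (λ i j → R i (suc j))) (ℤₚ.*-identityˡ g)) (zeros (laplaceTerm (firstOnly g ∷ R) ∘ suc) λ j →
    trans (cong (ℤ._* det (minor (firstOnly g ∷ R) (suc j))) (ℤₚ.*-zeroʳ (sgn (toℕ (suc j))))) (ℤₚ.*-zeroˡ (det (minor (firstOnly g ∷ R) (suc j))))))
    (ℤₚ.+-identityʳ _))
  where
  zeros : ∀ {k} (u : Fin k → ℤ) → (∀ j → u j ≡ + 0) → ΣFin u ≡ + 0
  zeros {zero}  u u≡0 = refl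
  zeros {suc k} u u≡0 rewrite u≡0 zero = trans (ℤₚ.+-identityˡ _) (zeros (u ∘ suc) (u≡0 ∘ suc))

module Residues (m : ℕ) where
  n : ℕ
  n = suc m

  open Congruence n public
  open Determinant n public
  open ≡-Reasoning

  Periodic : (ℤ → ℕ) → Set
  Periodic f = ∀ {a b} → a ≈ b → f a ≡ f b

  RowPeriodic : ∀ {k} → ((Fin k → ℤ) → ℕ) → Set
  RowPeriodic φ = ∀ v w → (∀ i → v i ≈ w i) → φ v ≡ φ w

  MatrixPeriodic : ∀ {r k} → ((Fin r → Fin k → ℤ) → ℕ) → Set
  MatrixPeriodic Φ = ∀ M N → (∀ i j → M i j ≈ N i j) → Φ M ≡ Φ N

  ∷-cong : ∀ {k} {a b : ℤ} {v w : Fin k → ℤ} → a ≈ b → (∀ i → v i ≈ w i) → ∀ i → (a ∷ v) i ≈ (b ∷ w) i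
  ∷-cong a≈b v≈w zero    = a≈b
  ∷-cong a≈b v≈w (suc i) = v≈w i

  ∷-congᴹ : ∀ {r k} {v w : Fin k → ℤ} {M N : Fin r → Fin k → ℤ} →
    (∀ j → v j ≈ w j) → (∀ i j → M i j ≈ N i j) → ∀ i j → (v ∷ M) i j ≈ (w ∷ N) i j
  ∷-congᴹ v≈w M≈N zero    = v≈w
  ∷-congᴹ v≈w M≈N (suc i) = M≈N i

  -- The shift trades the term at 1 for the term at n + 1, which is congruent to it.
  shift-one : ∀ {f} → Periodic f → residueSum n (λ a → f (+ 1 ℤ.+ a)) ≡ residueSum n f
  shift-one {f} per = ℕₚ.+-cancelʳ-≡ (f (+ 1)) _ _
    (trans (sumTo-shift (λ a → f (+ a)) n) (cong (residueSum n f ℕ.+_) (per (congruent (+ 1) (lemma (+ n))))))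
    where
    lemma : ∀ n → + 1 ℤ.+ n ≡ + 1 ℤ.+ + 1 ℤ.* n
    lemma = ℤ-solve-∀

  shift-ℕ : ∀ c {f} → Periodic f → residueSum n (λ a → f (a ℤ.+ + c)) ≡ residueSum n f
  shift-ℕ zero    per = ∑-cong (residueSum-isSum n) λ a → per (≈-reflexive (ℤₚ.+-identityʳ a))
  shift-ℕ (suc c) {f} per = begin
    residueSum n (λ a → f (a ℤ.+ + suc c))           ≡⟨ ∑-cong (residueSum-isSum n) (λ a → cong f (lemma a (+ c))) ⟩
    residueSum n (λ a → f (+ 1 ℤ.+ (a ℤ.+ + c)))     ≡⟨ shift-ℕ c (λ a≈b → per (+-congˡ (+ 1) a≈b)) ⟩
    residueSum n (λ a → f (+ 1 ℤ.+ a))               ≡⟨ shift-one per ⟩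
    residueSum n f                                   ∎
    where
    lemma : ∀ a c → a ℤ.+ (+ 1 ℤ.+ c) ≡ + 1 ℤ.+ (a ℤ.+ c)
    lemma = ℤ-solve-∀

  ≈-%ℕ : ∀ c → c ≈ + (c %ℕ n)
  ≈-%ℕ c = congruent (c /ℕ n) (a≡a%ℕn+[a/ℕn]*n c n)

  residueSum-shift : ∀ c {f} → Periodic f → residueSum n (λ a → f (a ℤ.+ c)) ≡ residueSum n f
  residueSum-shift c per = trans (∑-cong (residueSum-isSum n) λ a → per (+-congˡ a (≈-%ℕ c))) (shift-ℕ (c %ℕ n) per)

  -- With the source entry fixed, the target entry runs through a translate of the residues, and
  -- periodicity absorbs the translation. For `left` the two outer sums are exchanged first, so that
  -- the target is summed inside the source.
  rowSum-columnOp : ∀ {k} {s t : Fin (suc k)} → Adjacent s t → ∀ c {φ ψ : (Fin (suc k) → ℤ) → ℕ} → RowPeriodic φ →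
    (∀ v w → ColumnOp s t c v w → ψ v ≡ φ w) → rowSum n (suc k) ψ ≡ rowSum n (suc k) φ
  rowSum-columnOp {suc k} right c {φ} {ψ} per step = ∑-cong (residueSum-isSum n) λ a →
    trans (∑-cong (residueSum-isSum n) λ b → ∑-cong (rowSum-isSum n k) λ r →
             step (a ∷ (b ∷ r)) (a ∷ (b ℤ.+ c ℤ.* a ∷ r)) record
                         { off = λ { zero _ → ≈-refl ; (suc zero) j≢ → contradiction refl j≢ ; (suc (suc j)) _ → ≈-refl }
                         ; at = ≈-refl })
          (residueSum-shift (c ℤ.* a) {λ b → rowSum n k (λ r → φ (a ∷ (b ∷ r)))} λ b≈b′ → ∑-cong (rowSum-isSum n k) λ r →
             per _ _ (∷-cong ≈-refl (∷-cong b≈b′ λ _ → ≈-refl)))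
  rowSum-columnOp {suc k} left c {φ} {ψ} per step = begin
    residueSum n (λ a → residueSum n (λ b → rowSum n k (λ r → ψ (a ∷ (b ∷ r)))))
      ≡⟨ sumTo-swap (λ a b → rowSum n k (λ r → ψ (+ a ∷ (+ b ∷ r)))) n n ⟩
    residueSum n (λ b → residueSum n (λ a → rowSum n k (λ r → ψ (a ∷ (b ∷ r)))))
      ≡⟨ ∑-cong (residueSum-isSum n) (λ b → ∑-cong (residueSum-isSum n) λ a → ∑-cong (rowSum-isSum n k) λ r →
           step (a ∷ (b ∷ r)) (a ℤ.+ c ℤ.* b ∷ (b ∷ r)) record
             { off = λ { zero j≢ → contradiction refl j≢ ; (suc j) _ → ≈-refl } ; at = ≈-refl }) ⟩
    residueSum n (λ b → residueSum n (λ a → rowSum n k (λ r → φ (a ℤ.+ c ℤ.* b ∷ (b ∷ r)))))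
      ≡⟨ ∑-cong (residueSum-isSum n) (λ b →
           residueSum-shift (c ℤ.* b) {λ a → rowSum n k (λ r → φ (a ∷ (b ∷ r)))} λ a≈a′ → ∑-cong (rowSum-isSum n k) λ r →
             per _ _ (∷-cong a≈a′ λ _ → ≈-refl)) ⟩
    residueSum n (λ b → residueSum n (λ a → rowSum n k (λ r → φ (a ∷ (b ∷ r)))))
      ≡⟨ sumTo-swap (λ a b → rowSum n k (λ r → φ (+ a ∷ (+ b ∷ r)))) n n ⟨
    residueSum n (λ a → residueSum n (λ b → rowSum n k (λ r → φ (a ∷ (b ∷ r))))) ∎
  rowSum-columnOp {suc k} (shift adj) c per step = ∑-cong (residueSum-isSum n) λ a →
    rowSum-columnOp adj c (λ v w v≈w → per (a ∷ v) (a ∷ w) (∷-cong ≈-refl v≈w)) λ v w op → step (a ∷ v) (a ∷ w) record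
      { off = λ { zero _ → ≈-refl ; (suc j) j≢ → off op j (j≢ ∘ cong suc) } ; at = at op }

  matrixSum-columnOp : ∀ {k} {s t : Fin (suc k)} → Adjacent s t → ∀ c r {Φ Ψ : (Fin r → Fin (suc k) → ℤ) → ℕ} →
    MatrixPeriodic Φ → (∀ M N → (∀ i → ColumnOp s t c (M i) (N i)) → Ψ M ≡ Φ N) →
    matrixSum n r (suc k) Ψ ≡ matrixSum n r (suc k) Φ
  matrixSum-columnOp adj c zero    per step = step _ _ λ ()
  matrixSum-columnOp {k} adj c (suc r) {Φ} per step = rowSum-columnOp adj c
    (λ v w v≈w → ∑-cong (matrixSum-isSum n r (suc k)) λ R → per (v ∷ R) (w ∷ R) (∷-congᴹ v≈w λ _ _ → ≈-refl))
    λ v w op → matrixSum-columnOp adj c r (λ M N M≈N → per (w ∷ M) (w ∷ N) (∷-congᴹ (λ _ → ≈-refl) M≈N))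
      λ M N ops → step (v ∷ M) (w ∷ N) λ { zero → op ; (suc i) → ops i }

  -- The two properties of the number of completions of a first row on which the reduction rests;
  -- `extensions-invariant` provides them.
  record Invariant {k} (F : (Fin (suc k) → ℤ) → ℕ) : Set where
    field
      periodic : RowPeriodic F
      columnOp : ∀ {s t} → Adjacent s t → ∀ c v w → ColumnOp s t c v w → F w ≡ F v
  open Invariant

  module Front {k} {F : (Fin (suc (suc k)) → ℤ) → ℕ} (inv : Invariant F) where

    H : ℤ → ℤ → ℕ
    H a b = F (a ∷ firstOnly b)

    addˡ : ∀ a b c → H a (b ℤ.+ c ℤ.* a) ≡ H a b
    addˡ a b c = columnOp inv right c _ _ record
      { off = λ { zero _ → ≈-refl ; (suc zero) j≢ → contradiction refl j≢ ; (suc (suc j)) _ → ≈-refl } ; at = ≈-refl }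

    addʳ : ∀ a b c → H (a ℤ.+ c ℤ.* b) b ≡ H a b
    addʳ a b c = columnOp inv left c _ _ record
      { off = λ { zero j≢ → contradiction refl j≢ ; (suc j) _ → ≈-refl } ; at = ≈-refl }

    open Euclid H addˡ addʳ public

    H-periodic : ∀ {a b a′ b′} → a ≈ a′ → b ≈ b′ → H a b ≡ H a′ b′
    H-periodic a≈a′ b≈b′ = periodic inv _ _ (∷-cong a≈a′ (∷-cong b≈b′ λ _ → ≈-refl))

    H-first : ∀ a → H a (+ 0) ≡ F (firstOnly a)
    H-first a = periodic inv _ _ (∷-cong ≈-refl λ { zero → ≈-refl ; (suc j) → ≈-refl })

    modular-inverse : ∀ g → gcd g n ≡ 1 → Σ ℤ λ u → u ℤ.* + g ≈ + 1
    modular-inverse g g⊥n with coprime-Bézout (gcd≡1⇒coprime g⊥n)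
    ... | Bézout.+- x y eq = + x , congruent (+ y)
          (trans (sym (ℤₚ.pos-* x g)) (trans (cong +_ (sym eq)) (cong (ℤ._+_ (+ 1)) (ℤₚ.pos-* y n))))
    ... | Bézout.-+ x y eq = ℤ.- + x , congruent (ℤ.- + y)
          (lemma (+ x) (+ g) (+ y) (+ n)
            (trans (cong (ℤ._+_ (+ 1)) (sym (ℤₚ.pos-* x g))) (trans (cong +_ eq) (ℤₚ.pos-* y n))))
      where
      ring : ∀ x g → ℤ.- x ℤ.* g ≡ + 1 ℤ.+ ℤ.- (+ 1 ℤ.+ x ℤ.* g)
      ring = ℤ-solve-∀
      lemma : ∀ x g y n → + 1 ℤ.+ x ℤ.* g ≡ y ℤ.* n → ℤ.- x ℤ.* g ≡ + 1 ℤ.+ ℤ.- y ℤ.* n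
      lemma x g y n eq = trans (ring x g) (cong (ℤ._+_ (+ 1)) (trans (cong ℤ.-_ eq) (ℤₚ.neg-distribˡ-* y n)))

    -- With u an inverse of g modulo n, the second column serves as scratch space: (g, 0) → (g, ug)
    -- ≈ (g, 1) → (1, 1) → (1, 0). Having only one column rules this out, hence the separate counts
    -- for size 1.
    firstOnly-unit : ∀ g → gcd g n ≡ 1 → F (firstOnly (+ g)) ≡ F (firstOnly (+ 1))
    firstOnly-unit g g⊥n with modular-inverse g g⊥n
    ... | u , ug≈1 = begin
      F (firstOnly (+ g))                        ≡⟨ H-first (+ g) ⟨
      H (+ g) (+ 0)                              ≡⟨ addˡ (+ g) (+ 0) u ⟨
      H (+ g) (+ 0 ℤ.+ u ℤ.* + g)                ≡⟨ H-periodic (≈-refl {+ g}) (≈-reflexive (ℤₚ.+-identityˡ _) ▸ ug≈1) ⟩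
      H (+ g) (+ 1)                              ≡⟨ addʳ (+ g) (+ 1) (+ 1 ℤ.+ ℤ.- + g) ⟨
      H (+ g ℤ.+ (+ 1 ℤ.+ ℤ.- + g) ℤ.* + 1) (+ 1) ≡⟨ cong (λ x → H x (+ 1)) (ring (+ g)) ⟩
      H (+ 1) (+ 0 ℤ.+ + 1 ℤ.* + 1)              ≡⟨ addˡ (+ 1) (+ 0) (+ 1) ⟩
      H (+ 1) (+ 0)                              ≡⟨ H-first (+ 1) ⟩
      F (firstOnly (+ 1))                        ∎
      where
      ring : ∀ g → g ℤ.+ (+ 1 ℤ.+ ℤ.- g) ℤ.* + 1 ≡ + 1
      ring = ℤ-solve-∀

  tail-invariant : ∀ {k} {F : (Fin (suc (suc k)) → ℤ) → ℕ} → Invariant F → ∀ a → Invariant (λ v → F (a ∷ v))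
  tail-invariant inv a = record
    { periodic = λ v w v≈w → periodic inv (a ∷ v) (a ∷ w) (∷-cong ≈-refl v≈w)
    ; columnOp = λ adj c v w op → columnOp inv (shift adj) c (a ∷ v) (a ∷ w) record
        { off = λ { zero _ → ≈-refl ; (suc j) j≢ → off op j (j≢ ∘ cong suc) } ; at = at op } }

  -- The tail is reduced first, which leaves a row with two possibly nonzero entries in front; one
  -- run of Euclid merges them. This is the nesting of `gcdVec`.
  reduce-to-gcd : ∀ {k} {F : (Fin (suc k) → ℤ) → ℕ} → Invariant F → ∀ v → NonNegative v →
    F v ≡ F (firstOnly (+ gcdVec v))
  reduce-to-gcd {zero} inv v v≥0 = periodic inv _ _ λ { zero → ≈-reflexive (trans (v≥0 zero) (cong +_ (sym (gcd-identityʳ ℤ.∣ v zero ∣)))) }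
  reduce-to-gcd {suc k} {F} inv v v≥0 = begin
    F v                                              ≡⟨ periodic inv _ _ (λ { zero → ≈-refl ; (suc j) → ≈-refl }) ⟩
    F (v zero ∷ (v ∘ suc))
      ≡⟨ reduce-to-gcd (tail-invariant inv (v zero)) (v ∘ suc) (v≥0 ∘ suc) ⟩
    H (v zero) (+ gcdVec (v ∘ suc))                  ≡⟨ cong (λ x → H x (+ gcdVec (v ∘ suc))) (v≥0 zero) ⟩
    H (+ ℤ.∣ v zero ∣) (+ gcdVec (v ∘ suc))            ≡⟨ euclid _ ℤ.∣ v zero ∣ (gcdVec (v ∘ suc)) ℕₚ.≤-refl ⟩
    H (+ gcdVec v) (+ 0)                             ≡⟨ H-first (+ gcdVec v) ⟩
    F (firstOnly (+ gcdVec v))                       ∎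
    where open Front inv

  -- Once the first row is (1, 0, ..., 0), the entries below the 1 do not affect the determinant;
  -- each of them contributes a free factor n.
  matrixSum-dropColumn : ∀ r k {Φ : (Fin r → Fin k → ℤ) → ℕ} → MatrixPeriodic Φ →
    matrixSum n r (suc k) (λ R → Φ (λ i j → R i (suc j))) ≡ n ℕ.^ r ℕ.* matrixSum n r k Φ
  matrixSum-dropColumn zero    k {Φ} per = trans (per _ _ (λ ())) (sym (ℕₚ.+-identityʳ _))
  matrixSum-dropColumn (suc r) k {Φ} per = begin
    rowSum n (suc k) (λ v → matrixSum n r (suc k) (λ R → Φ (λ i j → (v ∷ R) i (suc j))))
      ≡⟨ ∑-cong (rowSum-isSum n (suc k)) (λ v → ∑-cong (matrixSum-isSum n r (suc k)) λ R →
           per (λ i j → (v ∷ R) i (suc j)) ((v ∘ suc) ∷ (λ i j → R i (suc j)))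
             (λ { zero j → ≈-refl ; (suc i) j → ≈-refl })) ⟩
    rowSum n (suc k) (λ v → matrixSum n r (suc k) (λ R → Φ ((v ∘ suc) ∷ (λ i j → R i (suc j)))))
      ≡⟨ ∑-cong (rowSum-isSum n (suc k)) (λ v → matrixSum-dropColumn r k λ M N M≈N → per ((v ∘ suc) ∷ M) ((v ∘ suc) ∷ N) (∷-congᴹ (λ _ → ≈-refl) M≈N)) ⟩
    rowSum n (suc k) (λ v → n ℕ.^ r ℕ.* matrixSum n r k (λ R → Φ ((v ∘ suc) ∷ R)))
      ≡⟨ ∑-* (rowSum-isSum n (suc k)) (n ℕ.^ r) (λ v → matrixSum n r k λ R → Φ ((v ∘ suc) ∷ R)) ⟩
    n ℕ.^ r ℕ.* residueSum n (λ _ → matrixSum n (suc r) k Φ)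
      ≡⟨ cong (n ℕ.^ r ℕ.*_) (sumTo-const _ n) ⟩
    n ℕ.^ r ℕ.* (n ℕ.* matrixSum n (suc r) k Φ)
      ≡⟨ lemma (n ℕ.^ r) n _ ⟩
    n ℕ.^ suc r ℕ.* matrixSum n (suc r) k Φ ∎
    where
    lemma : ∀ x n y → x ℕ.* (n ℕ.* y) ≡ n ℕ.* x ℕ.* y
    lemma = ℕ-solve-∀

  coprimeIndicator : ℕ → ℕ
  coprimeIndicator g = indicator (gcd g n ℕ.≟ 1)

  detSum : (ℤ → ℕ) → ℕ → ℕ
  detSum φ k = matrixSum n k k (φ ∘ det)

  -- The common ground of SL and GL: φ tests a determinant modulo n, and a multiple of a nonunit
  -- passes neither test.
  module DetSum {φ : ℤ → ℕ} (per : Periodic φ) (vanish : ∀ g x → gcd g n ≢ 1 → φ (+ g ℤ.* x) ≡ 0) where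

    extensions : ∀ k → (Fin (suc k) → ℤ) → ℕ
    extensions k v = matrixSum n k (suc k) (λ R → φ (det (v ∷ R)))

    -- The lower rows range over all residues, so the operation made on the first row can be made on
    -- them as well without changing the sum; the determinant is then preserved.
    extensions-invariant : ∀ k → Invariant (extensions k)
    extensions-invariant k = record
      { periodic = λ v w v≈w → ∑-cong (matrixSum-isSum n k (suc k)) λ R →
          per (det-cong {M = v ∷ R} {w ∷ R} (∷-congᴹ v≈w λ _ _ → ≈-refl))
      ; columnOp = λ adj c v w op → sym (matrixSum-columnOp adj c k
          (λ M N M≈N → per (det-cong {M = w ∷ M} {w ∷ N} (∷-congᴹ (λ _ → ≈-refl) M≈N)))
          (λ M N ops → per (≈-sym (det-columnOp adj c {v ∷ M} {w ∷ N} λ { zero → op ; (suc i) → ops i })))) }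

    extensions-firstOnly : ∀ k g → extensions k (firstOnly g) ≡ matrixSum n k (suc k) (λ R → φ (g ℤ.* det (λ i j → R i (suc j))))
    extensions-firstOnly k g = ∑-cong (matrixSum-isSum n k (suc k)) λ R → cong φ (det-firstOnly g R)

    extensions-gcd : ∀ k v → NonNegative v →
      extensions (suc k) v ≡ n ℕ.^ suc k ℕ.* detSum φ (suc k) ℕ.* coprimeIndicator (gcdVec v)
    extensions-gcd k v v≥0 with gcd (gcdVec v) n ℕ.≟ 1
    ... | no ¬g⊥n = begin
      extensions (suc k) v                         ≡⟨ reduce-to-gcd (extensions-invariant (suc k)) v v≥0 ⟩
      extensions (suc k) (firstOnly (+ gcdVec v))  ≡⟨ extensions-firstOnly (suc k) (+ gcdVec v) ⟩
      matrixSum n (suc k) (suc (suc k)) (λ R → φ (+ gcdVec v ℤ.* det (λ i j → R i (suc j))))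
        ≡⟨ ∑-cong (matrixSum-isSum n (suc k) (suc (suc k))) (λ R → vanish (gcdVec v) (det λ i j → R i (suc j)) ¬g⊥n) ⟩
      matrixSum n (suc k) (suc (suc k)) (λ R → 0)  ≡⟨ ∑-zero (matrixSum-isSum n (suc k) (suc (suc k))) ⟩
      0                                            ≡⟨ ℕₚ.*-zeroʳ (n ℕ.^ suc k ℕ.* detSum φ (suc k)) ⟨
      n ℕ.^ suc k ℕ.* detSum φ (suc k) ℕ.* 0
        ≡⟨ cong (n ℕ.^ suc k ℕ.* detSum φ (suc k) ℕ.*_) (indicator-false (gcd (gcdVec v) n ℕ.≟ 1) ¬g⊥n) ⟨
      n ℕ.^ suc k ℕ.* detSum φ (suc k) ℕ.* coprimeIndicator (gcdVec v) ∎
    ... | yes g⊥n = begin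
      extensions (suc k) v                         ≡⟨ reduce-to-gcd (extensions-invariant (suc k)) v v≥0 ⟩
      extensions (suc k) (firstOnly (+ gcdVec v))
        ≡⟨ Front.firstOnly-unit (extensions-invariant (suc k)) (gcdVec v) g⊥n ⟩
      extensions (suc k) (firstOnly (+ 1))         ≡⟨ extensions-firstOnly (suc k) (+ 1) ⟩
      matrixSum n (suc k) (suc (suc k)) (λ R → φ (+ 1 ℤ.* det (λ i j → R i (suc j))))
        ≡⟨ ∑-cong (matrixSum-isSum n (suc k) (suc (suc k))) (λ R → cong φ (ℤₚ.*-identityˡ (det λ i j → R i (suc j)))) ⟩
      matrixSum n (suc k) (suc (suc k)) (λ R → φ (det (λ i j → R i (suc j))))
        ≡⟨ matrixSum-dropColumn (suc k) (suc k) (λ M N M≈N → per (det-cong {M = M} {N} M≈N)) ⟩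
      n ℕ.^ suc k ℕ.* detSum φ (suc k)             ≡⟨ ℕₚ.*-identityʳ _ ⟨
      n ℕ.^ suc k ℕ.* detSum φ (suc k) ℕ.* 1
        ≡⟨ cong (n ℕ.^ suc k ℕ.* detSum φ (suc k) ℕ.*_) (indicator-true (gcd (gcdVec v) n ℕ.≟ 1) g⊥n) ⟨
      n ℕ.^ suc k ℕ.* detSum φ (suc k) ℕ.* coprimeIndicator (gcdVec v) ∎

    detSum-suc : ∀ k → detSum φ (suc (suc k)) ≡
      n ℕ.^ suc k ℕ.* detSum φ (suc k) ℕ.* rowSum n (suc (suc k)) (λ v → coprimeIndicator (gcdVec v))
    detSum-suc k = trans (rowSum-cong n (suc (suc k)) (extensions-gcd k))
                         (∑-* (rowSum-isSum n (suc (suc k))) (n ℕ.^ suc k ℕ.* detSum φ (suc k)) λ v → coprimeIndicator (gcdVec v))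

-- Counting SL and GL

listSum : ∀ {A : Set} → (A → ℕ) → List A → ℕ
listSum f List.[]       = 0
listSum f (x List.∷ xs) = f x ℕ.+ listSum f xs

listSum-cong : ∀ {A : Set} {f g : A → ℕ} → (∀ x → f x ≡ g x) → ∀ xs → listSum f xs ≡ listSum g xs
listSum-cong f≡g List.[]       = refl
listSum-cong f≡g (x List.∷ xs) = cong₂ ℕ._+_ (f≡g x) (listSum-cong f≡g xs)

listSum-++ : ∀ {A : Set} (f : A → ℕ) xs ys → listSum f (xs ++ ys) ≡ listSum f xs ℕ.+ listSum f ys
listSum-++ f List.[]       ys = refl
listSum-++ f (x List.∷ xs) ys = trans (cong (f x ℕ.+_) (listSum-++ f xs ys)) (sym (ℕₚ.+-assoc (f x) _ _))

listSum-map : ∀ {A B : Set} (f : B → ℕ) (g : A → B) xs → listSum f (map g xs) ≡ listSum (f ∘ g) xs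
listSum-map f g List.[]       = refl
listSum-map f g (x List.∷ xs) = cong (f (g x) ℕ.+_) (listSum-map f g xs)

listSum-concatMap : ∀ {A B : Set} (f : B → ℕ) (g : A → List B) xs → listSum f (concatMap g xs) ≡ listSum (λ x → listSum f (g x)) xs
listSum-concatMap f g List.[]       = refl
listSum-concatMap f g (x List.∷ xs) = trans (listSum-++ f (g x) (concatMap g xs)) (cong (listSum f (g x) ℕ.+_) (listSum-concatMap f g xs))

length-filter : ∀ {A : Set} {P : A → Set} (P? : ∀ x → Dec (P x)) xs → length (filter P? xs) ≡ listSum (λ x → indicator (P? x)) xs
length-filter P? List.[] = refl
length-filter P? (x List.∷ xs) with does (P? x)
... | true  = cong suc (length-filter P? xs)
... | false = length-filter P? xs

-- Used twice, for rows with congruence of entries as `_∼_` and for matrices with pointwise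
-- congruence of rows. The relation stands in for equality of functions, and it lets the list take 0
-- where the sum takes n.
listSum-allFuns : ∀ {A B : Set} {_∼_ : B → B → Set} (∼-refl : ∀ {b} → b ∼ b) (xs : List A) (ι : A → B)
  {S : (B → ℕ) → ℕ} → IsSum S → (∀ {f} → (∀ {a b} → a ∼ b → f a ≡ f b) → listSum (f ∘ ι) xs ≡ S f) →
  ∀ k (φ : (Fin k → B) → ℕ) → (∀ v w → (∀ i → v i ∼ w i) → φ v ≡ φ w) →
  listSum (λ g → φ (ι ∘ g)) (allFuns xs k) ≡ sumFun S k φ
listSum-allFuns ∼-refl xs ι s link zero φ resp = trans (ℕₚ.+-identityʳ _) (resp _ _ λ ())
listSum-allFuns {A} {B} {_∼_} ∼-refl xs ι {S} s link (suc k) φ resp = begin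
  listSum (λ g → φ (ι ∘ g)) (allFuns xs (suc k))
    ≡⟨ listSum-concatMap _ _ xs ⟩
  listSum (λ x → listSum (λ g → φ (ι ∘ g)) (map _ (allFuns xs k))) xs
    ≡⟨ listSum-cong (λ x → trans (listSum-map _ _ (allFuns xs k)) (listSum-cong (λ g → resp _ (ι x ∷ (ι ∘ g))
         λ { zero → ∼-refl ; (suc i) → ∼-refl }) (allFuns xs k))) xs ⟩
  listSum (λ x → listSum (λ g → φ (ι x ∷ (ι ∘ g))) (allFuns xs k)) xs
    ≡⟨ listSum-cong (λ x → listSum-allFuns ∼-refl xs ι s link k (λ v → φ (ι x ∷ v))
         λ v w v∼w → resp _ _ λ { zero → ∼-refl ; (suc i) → v∼w i }) xs ⟩
  listSum (λ x → sumFun S k (λ v → φ (ι x ∷ v))) xs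
    ≡⟨ link (λ a∼b → ∑-cong (sumFun-isSum s k) λ v → resp _ _ λ { zero → a∼b ; (suc i) → ∼-refl }) ⟩
  sumFun S (suc k) φ ∎
  where open ≡-Reasoning

sumTo-first : ∀ g n → sumTo g (suc n) ≡ g 1 ℕ.+ sumTo (g ∘ suc) n
sumTo-first g n = trans (sym (sumTo-shift g n)) (ℕₚ.+-comm (sumTo (g ∘ suc) n) (g 1))

-- Compares the ranges 1, ..., n and 0, ..., n - 1 without subtraction. For periodic summands the
-- two extra end terms cancel.
listSum-tabulate : ∀ {A : Set} n (h : Fin n → A) (φ : A → ℕ) (g : ℕ → ℕ) → (∀ i → φ (h i) ≡ g (toℕ i)) →
  sumTo g n ℕ.+ g 0 ≡ listSum φ (tabulate h) ℕ.+ g n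
listSum-tabulate zero    h φ g φ≡g = refl
listSum-tabulate (suc n) h φ g φ≡g = begin
  sumTo g (suc n) ℕ.+ g 0                                      ≡⟨ cong (ℕ._+ g 0) (sumTo-first g n) ⟩
  g 1 ℕ.+ sumTo (g ∘ suc) n ℕ.+ g 0                            ≡⟨ lemma (g 1) (sumTo (g ∘ suc) n) (g 0) ⟩
  g 0 ℕ.+ (sumTo (g ∘ suc) n ℕ.+ g 1)
    ≡⟨ cong (g 0 ℕ.+_) (listSum-tabulate n (h ∘ suc) φ (g ∘ suc) (φ≡g ∘ suc)) ⟩
  g 0 ℕ.+ (listSum φ (tabulate (h ∘ suc)) ℕ.+ g (suc n))       ≡⟨ ℕₚ.+-assoc (g 0) _ _ ⟨
  g 0 ℕ.+ listSum φ (tabulate (h ∘ suc)) ℕ.+ g (suc n)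
    ≡⟨ cong (λ x → x ℕ.+ listSum φ (tabulate (h ∘ suc)) ℕ.+ g (suc n)) (φ≡g zero) ⟨
  listSum φ (tabulate h) ℕ.+ g (suc n)                         ∎
  where
  open ≡-Reasoning
  lemma : ∀ a s b → a ℕ.+ s ℕ.+ b ≡ b ℕ.+ (s ℕ.+ a)
  lemma = ℕ-solve-∀

∣+⇒∣ : ∀ {d r} z → + r ≡ + d ℤ.* z → d ∣ₙ r
∣+⇒∣ {d} {r} z eq = divides ℤ.∣ z ∣ (trans (cong ℤ.∣_∣ eq) (trans (ℤₚ.abs-* (+ d) z) (ℕₚ.*-comm d ℤ.∣ z ∣)))

module Counting (m : ℕ) where
  open Residues m

  listSum-allMatrices : ∀ k (φ : ℤ → ℕ) → Periodic φ → listSum (λ M → φ (det (lift M))) (allMatrices n k) ≡ detSum φ k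
  listSum-allMatrices k φ per = listSum-allFuns {_∼_ = λ v w → ∀ i → v i ≈ w i} (λ i → ≈-refl) (allFuns (allFin n) k) (λ v i → + toℕ (v i))
    (rowSum-isSum n k) rows k (φ ∘ det) (λ M N M≈N → per (det-cong M≈N))
    where
    entries : ∀ {f : ℤ → ℕ} → (∀ {a b} → a ≈ b → f a ≡ f b) → listSum (λ i → f (+ toℕ i)) (allFin n) ≡ residueSum n f
    entries {f} per = sym (ℕₚ.+-cancelʳ-≡ (f (+ 0)) _ _
      (trans (listSum-tabulate n id (λ i → f (+ toℕ i)) (λ a → f (+ a)) (λ i → refl))
        (cong (listSum (λ i → f (+ toℕ i)) (allFin n) ℕ.+_) (per (congruent (+ 1) (lemma (+ n)))))))
      where
      lemma : ∀ n → n ≡ + 0 ℤ.+ + 1 ℤ.* n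
      lemma = ℤ-solve-∀
    rows : ∀ {f : (Fin k → ℤ) → ℕ} → (∀ {v w} → (∀ i → v i ≈ w i) → f v ≡ f w) →
      listSum (λ v → f (λ i → + toℕ (v i))) (allFuns (allFin n) k) ≡ rowSum n k f
    rows {f} per = listSum-allFuns {_∼_ = _≈_} ≈-refl (allFin n) (λ i → + toℕ i) (residueSum-isSum n) entries k f (λ v w → per)

  ≈-unique : ∀ {r s} → r ℕ.< n → s ℕ.< n → + r ≈ + s → r ≡ s
  ≈-unique {r} {s} r<n s<n (congruent (+ zero) eq) = ℤₚ.+-injective (trans eq (ℤₚ.+-identityʳ (+ s)))
  ≈-unique {r} {s} r<n s<n (congruent (+ suc c) eq) = contradiction r<n (ℕₚ.≤⇒≯ (begin
    n                       ≤⟨ ℕₚ.m≤m+n n (c ℕ.* n) ⟩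
    suc c ℕ.* n             ≤⟨ ℕₚ.m≤n+m (suc c ℕ.* n) s ⟩
    s ℕ.+ suc c ℕ.* n       ≡⟨ ℤₚ.+-injective (trans eq (cong (ℤ._+_ (+ s)) (sym (ℤₚ.pos-* (suc c) n)))) ⟨
    r                       ∎))
    where open ℕₚ.≤-Reasoning
  ≈-unique {r} {s} r<n s<n (congruent -[1+ c ] eq) = contradiction s<n (ℕₚ.≤⇒≯ (begin
    n                       ≤⟨ ℕₚ.m≤m+n n (c ℕ.* n) ⟩
    suc c ℕ.* n             ≤⟨ ℕₚ.m≤n+m (suc c ℕ.* n) r ⟩
    r ℕ.+ suc c ℕ.* n
      ≡⟨ ℤₚ.+-injective (trans (cong (ℤ._+_ (+ r)) (ℤₚ.pos-* (suc c) n)) (trans (cong (ℤ._+ (+ suc c ℤ.* + n)) eq) (lemma (+ s) (+ suc c) (+ n)))) ⟩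
    s                       ∎))
    where
    open ℕₚ.≤-Reasoning
    lemma : ∀ s c n → s ℤ.+ ℤ.- c ℤ.* n ℤ.+ c ℤ.* n ≡ s
    lemma = ℤ-solve-∀

  %ℕ-cong : ∀ {a b} → a ≈ b → a %ℕ n ≡ b %ℕ n
  %ℕ-cong {a} {b} a≈b = ≈-unique (n%ℕd<d a n) (n%ℕd<d b n) (≈-trans (≈-sym (≈-%ℕ a)) (≈-trans a≈b (≈-%ℕ b)))

  SL-indicator : ℤ → ℕ
  SL-indicator d = indicator ((d ℤ.- ℤ.1ℤ) %ℕ n ℕ.≟ 0)

  GL-indicator : ℤ → ℕ
  GL-indicator d = indicator (gcd (d %ℕ n) n ℕ.≟ 1)

  SL-periodic : Periodic SL-indicator
  SL-periodic a≈b = cong (λ r → indicator (r ℕ.≟ 0)) (%ℕ-cong (+-cong a≈b (≈-refl {ℤ.- ℤ.1ℤ})))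

  GL-periodic : Periodic GL-indicator
  GL-periodic a≈b = cong (λ r → indicator (gcd r n ℕ.≟ 1)) (%ℕ-cong a≈b)

  gcd-∣-combination : ∀ g x y {r} → + r ≡ + g ℤ.* x ℤ.+ y ℤ.* + n → gcd g n ∣ₙ r
  gcd-∣-combination g x y {r} eq with gcd[m,n]∣m g n | gcd[m,n]∣n g n
  ... | divides a g≡ | divides b n≡ = ∣+⇒∣ (+ a ℤ.* x ℤ.+ y ℤ.* + b) (begin
    + r                                                      ≡⟨ eq ⟩
    + g ℤ.* x ℤ.+ y ℤ.* + n
      ≡⟨ cong₂ (λ g n → g ℤ.* x ℤ.+ y ℤ.* n) (trans (cong +_ g≡) (ℤₚ.pos-* a d)) (trans (cong +_ n≡) (ℤₚ.pos-* b d)) ⟩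
    + a ℤ.* + d ℤ.* x ℤ.+ y ℤ.* (+ b ℤ.* + d)                ≡⟨ lemma (+ a) (+ b) (+ d) x y ⟩
    + d ℤ.* (+ a ℤ.* x ℤ.+ y ℤ.* + b)                        ∎)
    where
    open ≡-Reasoning
    d = gcd g n
    lemma : ∀ a b d x y → a ℤ.* d ℤ.* x ℤ.+ y ℤ.* (b ℤ.* d) ≡ d ℤ.* (a ℤ.* x ℤ.+ y ℤ.* b)
    lemma = ℤ-solve-∀

  -- If g x were 1 modulo n, then 1 would be an integral combination of g and n, and their gcd would
  -- divide it.
  SL-vanish : ∀ g x → gcd g n ≢ 1 → SL-indicator (+ g ℤ.* x) ≡ 0
  SL-vanish g x g⊥̸n = indicator-false ((+ g ℤ.* x ℤ.- ℤ.1ℤ) %ℕ n ℕ.≟ 0) λ r≡0 →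
    g⊥̸n (∣1⇒≡1 (gcd-∣-combination g x (ℤ.- q) {1} (lemma (+ g ℤ.* x) (+ r) q (+ n) (cong +_ r≡0) (a≡a%ℕn+[a/ℕn]*n (+ g ℤ.* x ℤ.- ℤ.1ℤ) n))))
    where
    r = (+ g ℤ.* x ℤ.- ℤ.1ℤ) %ℕ n
    q = (+ g ℤ.* x ℤ.- ℤ.1ℤ) /ℕ n
    shuffle : ∀ a → ℤ.1ℤ ≡ a ℤ.+ ℤ.- (a ℤ.- ℤ.1ℤ)
    shuffle = ℤ-solve-∀
    negate : ∀ q n → ℤ.- (+ 0 ℤ.+ q ℤ.* n) ≡ ℤ.- q ℤ.* n
    negate = ℤ-solve-∀
    lemma : ∀ (a r q n : ℤ) → r ≡ + 0 → a ℤ.- ℤ.1ℤ ≡ r ℤ.+ q ℤ.* n → ℤ.1ℤ ≡ a ℤ.+ ℤ.- q ℤ.* n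
    lemma a r q n refl eq = trans (shuffle a) (cong (ℤ._+_ a) (trans (cong ℤ.-_ eq) (negate q n)))

  GL-vanish : ∀ g x → gcd g n ≢ 1 → GL-indicator (+ g ℤ.* x) ≡ 0
  GL-vanish g x g⊥̸n = indicator-false (gcd r n ℕ.≟ 1) λ r⊥n → g⊥̸n (∣1⇒≡1 (subst (gcd g n ∣ₙ_) r⊥n
    (gcd-greatest {r} {n} (gcd-∣-combination g x (ℤ.- q) {r} (lemma (+ g ℤ.* x) (+ r) (a≡a%ℕn+[a/ℕn]*n (+ g ℤ.* x) n))) (gcd[m,n]∣n g n))))
    where
    r = (+ g ℤ.* x) %ℕ n
    q = (+ g ℤ.* x) /ℕ n
    shuffle : ∀ r y → r ≡ r ℤ.+ y ℤ.- y
    shuffle = ℤ-solve-∀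
    lemma : ∀ a r → a ≡ r ℤ.+ q ℤ.* + n → r ≡ a ℤ.+ ℤ.- q ℤ.* + n
    lemma a r eq = trans (shuffle r (q ℤ.* + n)) (cong₂ ℤ._+_ (sym eq) (ℤₚ.neg-distribˡ-* q (+ n)))

  #SL≡detSum : ∀ k → #SL k m ≡ detSum SL-indicator k
  #SL≡detSum k = trans (length-filter _ (allMatrices n k)) (listSum-allMatrices k SL-indicator SL-periodic)

  #GL≡detSum : ∀ k → #GL k m ≡ detSum GL-indicator k
  #GL≡detSum k = trans (length-filter _ (allMatrices n k)) (listSum-allMatrices k GL-indicator GL-periodic)

  jordan : ℕ → ℕ
  jordan k = rowSum n k (λ v → coprimeIndicator (gcdVec v))

  detSum-one : ∀ {φ} → Periodic φ → detSum φ 1 ≡ residueSum n φ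
  detSum-one {φ} per = ∑-cong (residueSum-isSum n) λ a → cong φ (lemma a)
    where
    lemma : ∀ a → + 1 ℤ.* a ℤ.* + 1 ℤ.+ + 0 ≡ a
    lemma = ℤ-solve-∀

  SL-one : #SL 1 m ≡ 1
  SL-one = trans (#SL≡detSum 1) (trans (detSum-one SL-periodic) (count m ℕₚ.≤-refl))
    where
    -- The residue a = j + 1 leaves remainder j after subtracting 1, so among 1, ..., n only a = 1
    -- is counted.
    term : ∀ j → j ℕ.< n → (+ suc j ℤ.- ℤ.1ℤ) %ℕ n ≡ j
    term j j<n = m<n⇒m%n≡m j<n
    count : ∀ j → j ℕ.< n → sumTo (λ a → SL-indicator (+ a)) (suc j) ≡ 1
    count zero    j<n = indicator-true ((+ 1 ℤ.- ℤ.1ℤ) %ℕ n ℕ.≟ 0) (term 0 j<n)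
    count (suc j) j<n = cong₂ ℕ._+_ (count j (ℕₚ.<-trans (ℕₚ.n<1+n j) j<n))
      (indicator-false ((+ suc (suc j) ℤ.- ℤ.1ℤ) %ℕ n ℕ.≟ 0) λ r≡0 → ℕₚ.1+n≢0 (trans (sym (term (suc j) j<n)) r≡0))

  GL-one : #GL 1 m ≡ jordan 1
  GL-one = trans (#GL≡detSum 1) (trans (detSum-one GL-periodic) (sumTo-cong (λ a → cong (λ g → indicator (g ℕ.≟ 1)) (trans (gcd-% a) (cong (λ g → gcd g n) (sym (gcd-identityʳ a))))) n))
    where
    gcd-% : ∀ a → gcd (a ℕ.% n) n ≡ gcd a n
    gcd-% a = (gcd-universality {a} {n} {gcd (a ℕ.% n) n}
      (λ (d∣a , d∣n) → gcd-greatest (%-presˡ-∣ {n = n} {m = a} d∣a d∣n) d∣n)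
      (λ {d} d∣g → let d∣n = ∣-trans d∣g (gcd[m,n]∣n (a ℕ.% n) n) in
        ∣n∣m%n⇒∣m {n} {d} {a} d∣n (∣-trans d∣g (gcd[m,n]∣m (a ℕ.% n) n)) , d∣n))

  SL-suc : ∀ k → #SL (suc (suc k)) m ≡ n ℕ.^ suc k ℕ.* #SL (suc k) m ℕ.* jordan (suc (suc k))
  SL-suc k = trans (#SL≡detSum (suc (suc k))) (trans (DetSum.detSum-suc SL-periodic SL-vanish k)
    (cong (λ x → n ℕ.^ suc k ℕ.* x ℕ.* jordan (suc (suc k))) (sym (#SL≡detSum (suc k)))))

  GL-suc : ∀ k → #GL (suc (suc k)) m ≡ n ℕ.^ suc k ℕ.* #GL (suc k) m ℕ.* jordan (suc (suc k))
  GL-suc k = trans (#GL≡detSum (suc (suc k))) (trans (DetSum.detSum-suc GL-periodic GL-vanish k)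
    (cong (λ x → n ℕ.^ suc k ℕ.* x ℕ.* jordan (suc (suc k))) (sym (#GL≡detSum (suc k)))))

-- Rational arithmetic

zero? : ∀ x → Maybe (0ℚ ≡ x)
zero? x with 0ℚ ℚₚ.≟ x
... | yes p = just p
... | no _  = nothing

ℚ-ring : AlmostCommutativeRing 0ℓ 0ℓ
ℚ-ring = fromCommutativeRing ℚₚ.+-*-commutativeRing zero?

toℚᵘ-qN : ∀ n → toℚᵘ (qN n) ℚᵘ.≃ mkℚᵘ (+ n) 0
toℚᵘ-qN n = ℚₚ.toℚᵘ-fromℚᵘ (mkℚᵘ (+ n) 0)

qN-+ : ∀ a b → qN (a ℕ.+ b) ≡ qN a + qN b
qN-+ a b = ℚₚ.toℚᵘ-injective (begin
  toℚᵘ (qN (a ℕ.+ b))                ≈⟨ toℚᵘ-qN (a ℕ.+ b) ⟩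
  mkℚᵘ (+ (a ℕ.+ b)) 0
    ≈⟨ *≡* (cong (ℤ._* + 1) (trans (ℤₚ.pos-+ a b) (sym (cong₂ ℤ._+_ (ℤₚ.*-identityʳ (+ a)) (ℤₚ.*-identityʳ (+ b)))))) ⟩
  mkℚᵘ (+ a) 0 ℚᵘ.+ mkℚᵘ (+ b) 0     ≈⟨ ℚᵘₚ.+-cong (toℚᵘ-qN a) (toℚᵘ-qN b) ⟨
  toℚᵘ (qN a) ℚᵘ.+ toℚᵘ (qN b)       ≈⟨ ℚₚ.toℚᵘ-homo-+ (qN a) (qN b) ⟨
  toℚᵘ (qN a + qN b)                 ∎)
  where open ℚᵘₚ.≃-Reasoning

qN-* : ∀ a b → qN (a ℕ.* b) ≡ qN a * qN b
qN-* a b = ℚₚ.toℚᵘ-injective (begin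
  toℚᵘ (qN (a ℕ.* b))                ≈⟨ toℚᵘ-qN (a ℕ.* b) ⟩
  mkℚᵘ (+ (a ℕ.* b)) 0               ≈⟨ *≡* (cong (ℤ._* + 1) (ℤₚ.pos-* a b)) ⟩
  mkℚᵘ (+ a) 0 ℚᵘ.* mkℚᵘ (+ b) 0     ≈⟨ ℚᵘₚ.*-cong (toℚᵘ-qN a) (toℚᵘ-qN b) ⟨
  toℚᵘ (qN a) ℚᵘ.* toℚᵘ (qN b)       ≈⟨ ℚₚ.toℚᵘ-homo-* (qN a) (qN b) ⟨
  toℚᵘ (qN a * qN b)                 ∎)
  where open ℚᵘₚ.≃-Reasoning

qN-mono : ∀ {a b} → a ℕ.≤ b → qN a ≤ qN b
qN-mono {a} {b} a≤b = ℚₚ.toℚᵘ-cancel-≤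
  (ℚᵘₚ.≤-respˡ-≃ (ℚᵘₚ.≃-sym (toℚᵘ-qN a)) (ℚᵘₚ.≤-respʳ-≃ (ℚᵘₚ.≃-sym (toℚᵘ-qN b))
    (*≤* (ℤₚ.*-monoʳ-≤-nonNeg (+ 1) (ℤ.+≤+ a≤b)))))

qN*inv : ∀ m → qN (suc m) * inv (suc m) ≡ 1ℚ
qN*inv m = ℚₚ.toℚᵘ-injective (begin
  toℚᵘ (qN (suc m) * inv (suc m))            ≈⟨ ℚₚ.toℚᵘ-homo-* (qN (suc m)) (inv (suc m)) ⟩
  toℚᵘ (qN (suc m)) ℚᵘ.* toℚᵘ (inv (suc m))  ≈⟨ ℚᵘₚ.*-cong (toℚᵘ-qN (suc m)) (ℚₚ.toℚᵘ-fromℚᵘ (mkℚᵘ (+ 1) m)) ⟩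
  mkℚᵘ (+ suc m) 0 ℚᵘ.* mkℚᵘ (+ 1) m         ≈⟨ *≡* (cong +_ (lemma m)) ⟩
  toℚᵘ 1ℚ                                    ∎)
  where
  open ℚᵘₚ.≃-Reasoning
  lemma : ∀ m → suc m ℕ.* 1 ℕ.* 1 ≡ suc (m ℕ.+ 0 ℕ.+ 0)
  lemma m = trans (ℕₚ.*-identityʳ _) (trans (ℕₚ.*-identityʳ _) (cong suc (sym (trans (ℕₚ.+-identityʳ _) (ℕₚ.+-identityʳ m)))))

0≤qN : ∀ n → 0ℚ ≤ qN n
0≤qN n = qN-mono (ℕ.z≤n {n})

0≤inv : ∀ n → 0ℚ ≤ inv n
0≤inv zero    = ℚₚ.≤-refl
0≤inv (suc m) = ℚₚ.nonNegative⁻¹ (inv (suc m)) {{ℚₚ.normalize-nonNeg 1 (suc m)}}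

0≤+ : ∀ {x y} → 0ℚ ≤ x → 0ℚ ≤ y → 0ℚ ≤ x + y
0≤+ 0≤x 0≤y = ℚₚ.+-mono-≤ 0≤x 0≤y

0≤* : ∀ {x y} → 0ℚ ≤ x → 0ℚ ≤ y → 0ℚ ≤ x * y
0≤* {x} {y} 0≤x 0≤y = ℚₚ.nonNegative⁻¹ (x * y)
  {{ℚₚ.nonNeg*nonNeg⇒nonNeg x {{ℚ.nonNegative 0≤x}} y {{ℚ.nonNegative 0≤y}}}}

0≤1 : 0ℚ ≤ 1ℚ
0≤1 = 0≤qN 1

≤⇒0≤- : ∀ {x y} → x ≤ y → 0ℚ ≤ y - x
≤⇒0≤- {x} {y} x≤y = subst (_≤ y - x) (ℚₚ.+-inverseʳ x) (ℚₚ.+-monoˡ-≤ (- x) x≤y)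

-- Turns a polynomial inequality into a ring identity that the solver can check.
≤-by : ∀ {x y} d → 0ℚ ≤ d → y ≡ x + d → x ≤ y
≤-by {x} d 0≤d refl = subst (_≤ x + d) (ℚₚ.+-identityʳ x) (ℚₚ.+-monoʳ-≤ x 0≤d)

*-monoˡ : ∀ {r x y} → 0ℚ ≤ r → x ≤ y → r * x ≤ r * y
*-monoˡ {r} 0≤r x≤y = ℚₚ.*-monoˡ-≤-nonNeg r {{ℚ.nonNegative 0≤r}} x≤y

*-monoʳ : ∀ {r x y} → 0ℚ ≤ r → x ≤ y → x * r ≤ y * r
*-monoʳ {r} 0≤r x≤y = ℚₚ.*-monoʳ-≤-nonNeg r {{ℚ.nonNegative 0≤r}} x≤y

*-mono : ∀ {x y u v} → 0ℚ ≤ u → 0ℚ ≤ y → x ≤ y → u ≤ v → x * u ≤ y * v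
*-mono 0≤u 0≤y x≤y u≤v = ℚₚ.≤-trans (*-monoʳ 0≤u x≤y) (*-monoˡ 0≤y u≤v)

inv-unique : ∀ n x → qN (suc n) * x ≡ 1ℚ → x ≡ inv (suc n)
inv-unique n x eq = begin
  x                                  ≡⟨ lemma (qN (suc n)) (inv (suc n)) x (qN*inv n) ⟩
  inv (suc n) * (qN (suc n) * x)     ≡⟨ cong (inv (suc n) *_) eq ⟩
  inv (suc n) * 1ℚ                   ≡⟨ ℚₚ.*-identityʳ _ ⟩
  inv (suc n)                        ∎
  where
  open ≡-Reasoning
  assoc : ∀ a b x → b * (a * x) ≡ a * b * x
  assoc = ring-solve-∀ ℚ-ring
  lemma : ∀ a b x → a * b ≡ 1ℚ → x ≡ b * (a * x)
  lemma a b x eq = sym (trans (assoc a b x) (trans (cong (_* x) eq) (ℚₚ.*-identityˡ x)))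

inv-* : ∀ a b → inv (a ℕ.* b) ≡ inv a * inv b
inv-* zero    b       = sym (ℚₚ.*-zeroˡ (inv b))
inv-* (suc a) zero    rewrite ℕₚ.*-zeroʳ a = sym (ℚₚ.*-zeroʳ (inv (suc a)))
inv-* (suc a) (suc b) = sym (inv-unique (b ℕ.+ a ℕ.* suc b) (inv (suc a) * inv (suc b)) (begin
  qN (suc a ℕ.* suc b) * (inv (suc a) * inv (suc b))
    ≡⟨ cong (_* (inv (suc a) * inv (suc b))) (qN-* (suc a) (suc b)) ⟩
  qN (suc a) * qN (suc b) * (inv (suc a) * inv (suc b))
    ≡⟨ lemma (qN (suc a)) (qN (suc b)) (inv (suc a)) (inv (suc b)) ⟩
  qN (suc a) * inv (suc a) * (qN (suc b) * inv (suc b))     ≡⟨ cong₂ _*_ (qN*inv a) (qN*inv b) ⟩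
  1ℚ                                                        ∎))
  where
  open ≡-Reasoning
  lemma : ∀ a b x y → a * b * (x * y) ≡ a * x * (b * y)
  lemma = ring-solve-∀ ℚ-ring

-- Read with suc m = p - 1, this turns the largest possible loss at a prime p into a difference of
-- consecutive terms.
inv-telescope : ∀ m → inv (suc m) * inv (suc (suc m)) ≡ inv (suc m) - inv (suc (suc m))
inv-telescope m = begin
  u * v
    ≡⟨ cong (u *_) (trans (sym (ℚₚ.*-identityˡ v)) (cong (_* v) (lemma₀ (qN (suc m))))) ⟩
  u * ((1ℚ + qN (suc m) - qN (suc m)) * v)    ≡⟨ cong (λ x → u * ((x - qN (suc m)) * v)) (sym (qN-+ 1 (suc m))) ⟩
  u * ((qN (suc (suc m)) - qN (suc m)) * v)   ≡⟨ lemma u v (qN (suc m)) (qN (suc (suc m))) ⟩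
  u * (qN (suc (suc m)) * v) - (qN (suc m) * u) * v  ≡⟨ cong₂ (λ x y → u * x - y * v) (qN*inv (suc m)) (qN*inv m) ⟩
  u * 1ℚ - 1ℚ * v                            ≡⟨ cong₂ _-_ (ℚₚ.*-identityʳ u) (ℚₚ.*-identityˡ v) ⟩
  u - v                                      ∎
  where
  open ≡-Reasoning
  u = inv (suc m)
  v = inv (suc (suc m))
  lemma₀ : ∀ x → 1ℚ ≡ 1ℚ + x - x
  lemma₀ = ring-solve-∀ ℚ-ring
  lemma : ∀ u v a b → u * ((b - a) * v) ≡ u * (b * v) - (a * u) * v
  lemma = ring-solve-∀ ℚ-ring

-- Partial sums and products over primes

-- The addition is a parameter because `partial-multiples` serves the mean value over ℚ and the
-- sieve over ℕ.
module PartialSum {A : Set} (_⊕_ : A → A → A) (𝟘 : A) (⊕-identityʳ : ∀ x → x ⊕ 𝟘 ≡ x) where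

  partial : (ℕ → A) → ℕ → A
  partial f zero    = 𝟘
  partial f (suc n) = partial f n ⊕ f (suc n)

  partial-cong : ∀ {f g} n → (∀ m → suc m ℕ.≤ n → f (suc m) ≡ g (suc m)) → partial f n ≡ partial g n
  partial-cong zero    f≡g = refl
  partial-cong (suc n) f≡g = cong₂ _⊕_ (partial-cong n λ m m<n → f≡g m (ℕₚ.m≤n⇒m≤1+n m<n)) (f≡g n ℕₚ.≤-refl)

  -- The quotient is given by its two inequalities, not as `n / p`, so that induction on n can keep
  -- q or, when n + 1 is a multiple of p, lower it by one.
  partial-multiples : ∀ p .{{_ : NonZero p}} {f} → (∀ m → ¬ p ∣ₙ m → f m ≡ 𝟘) →
    ∀ n q → q ℕ.* p ℕ.≤ n → n ℕ.< suc q ℕ.* p → partial f n ≡ partial (λ j → f (j ℕ.* p)) q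
  partial-multiples p         off zero    zero    _ _ = refl
  partial-multiples (suc p)   off zero    (suc q) () _
  partial-multiples (suc p-1) {f} off (suc n) q lo hi with q ℕ.* suc p-1 ℕ.≟ suc n
  ... | no qp≢n = trans (cong₂ _⊕_
          (partial-multiples (suc p-1) off n q (ℕ.s≤s⁻¹ qp<1+n) (ℕₚ.<-trans (ℕₚ.n<1+n n) hi)) (off (suc n) p∤1+n))
        (⊕-identityʳ _)
    where
    qp<1+n = ℕₚ.≤∧≢⇒< lo qp≢n
    p∤1+n : ¬ suc p-1 ∣ₙ suc n
    p∤1+n (divides r eq) = ℕₚ.<⇒≱
      (ℕₚ.*-cancelʳ-< (suc p-1) q r (subst (q ℕ.* suc p-1 ℕ.<_) eq qp<1+n))
      (ℕ.s≤s⁻¹ (ℕₚ.*-cancelʳ-< (suc p-1) r (suc q) (subst (ℕ._< suc q ℕ.* suc p-1) eq hi)))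
  partial-multiples (suc p-1) {f} off (suc n) (suc q) lo hi | yes eq = cong₂ _⊕_
    (partial-multiples (suc p-1) off n q
      (ℕₚ.≤-trans (ℕₚ.m≤n+m _ p-1) (ℕₚ.≤-reflexive (cong ℕ.pred eq))) (ℕₚ.≤-reflexive (sym eq)))
    (cong f (sym eq))

open PartialSum _+_ 0ℚ ℚₚ.+-identityʳ

partial-linear : ∀ c (a b : ℕ → ℚ) n → partial (λ m → a m - c * b m) n ≡ partial a n - c * partial b n
partial-linear c a b zero    = lemma c
  where
  lemma : ∀ c → 0ℚ ≡ 0ℚ - c * 0ℚ
  lemma = ring-solve-∀ ℚ-ring
partial-linear c a b (suc n) rewrite partial-linear c a b n = lemma c (partial a n) (partial b n) (a (suc n)) (b (suc n))
  where
  lemma : ∀ c a b x y → a - c * b + (x - c * y) ≡ a + x - c * (b + y)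
  lemma = ring-solve-∀ ℚ-ring

partial-one : ∀ n → partial (λ _ → 1ℚ) n ≡ qN n
partial-one zero    = refl
partial-one (suc n) = begin
  partial (λ _ → 1ℚ) n + 1ℚ     ≡⟨ cong (_+ 1ℚ) (partial-one n) ⟩
  qN n + qN 1                   ≡⟨ qN-+ n 1 ⟨
  qN (n ℕ.+ 1)                  ≡⟨ cong qN (ℕₚ.+-comm n 1) ⟩
  qN (suc n)                    ∎
  where open ≡-Reasoning

partial-nonneg : ∀ {a : ℕ → ℚ} n → (∀ m → 0ℚ ≤ a m) → 0ℚ ≤ partial a n
partial-nonneg zero    0≤a = ℚₚ.≤-refl
partial-nonneg (suc n) 0≤a = 0≤+ (partial-nonneg n 0≤a) (0≤a (suc n))

partial-mono : ∀ {a b : ℕ → ℚ} n → (∀ m → a m ≤ b m) → partial a n ≤ partial b n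
partial-mono zero    a≤b = ℚₚ.≤-refl
partial-mono (suc n) a≤b = ℚₚ.+-mono-≤ (partial-mono n a≤b) (a≤b (suc n))

qN-sumTo : ∀ f n → qN (sumTo f n) ≡ partial (λ m → qN (f m)) n
qN-sumTo f zero    = refl
qN-sumTo f (suc n) = trans (qN-+ (sumTo f n) (f (suc n))) (cong (_+ qN (f (suc n))) (qN-sumTo f n))

primeProd-prime : ∀ g {M} → Prime (suc M) → primeProd g (suc M) ≡ primeProd g M * g (suc M)
primeProd-prime g {M} pr rewrite dec-true (prime? (suc M)) pr = refl

primeProd-¬prime : ∀ g {M} → ¬ Prime (suc M) → primeProd g (suc M) ≡ primeProd g M
primeProd-¬prime g {M} ¬pr rewrite dec-false (prime? (suc M)) ¬pr = refl

primeProd-cong : ∀ {g h : ℕ → ℚ} L → (∀ p → Prime p → p ℕ.≤ L → g p ≡ h p) → primeProd g L ≡ primeProd h L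
primeProd-cong zero eq = refl
primeProd-cong {g} {h} (suc L) eq with prime? (suc L)
... | yes pr = cong₂ _*_ (primeProd-cong L λ p pr′ p≤L → eq p pr′ (ℕₚ.m≤n⇒m≤1+n p≤L)) (eq (suc L) pr ℕₚ.≤-refl)
... | no _   = primeProd-cong L λ p pr′ p≤L → eq p pr′ (ℕₚ.m≤n⇒m≤1+n p≤L)

UnitInterval : ℚ → Set
UnitInterval x = 0ℚ ≤ x × x ≤ 1ℚ

unit-* : ∀ {x y} → UnitInterval x → UnitInterval y → UnitInterval (x * y)
unit-* (0≤x , x≤1) (0≤y , y≤1) = 0≤* 0≤x 0≤y , *-mono 0≤y 0≤1 x≤1 y≤1

unit-complement : ∀ {x} → UnitInterval x → UnitInterval (1ℚ - x)
unit-complement {x} (0≤x , x≤1) = ≤⇒0≤- x≤1 , ≤-by x 0≤x (lemma x)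
  where
  lemma : ∀ x → 1ℚ ≡ 1ℚ - x + x
  lemma = ring-solve-∀ ℚ-ring

unit-one : UnitInterval 1ℚ
unit-one = 0≤1 , ℚₚ.≤-refl

unit-if : ∀ (b : Bool) {x y} → UnitInterval x → UnitInterval y → UnitInterval (if b then x else y)
unit-if true  ux uy = ux
unit-if false ux uy = uy

primeProd-unit : ∀ {g : ℕ → ℚ} L → (∀ p → Prime p → UnitInterval (g p)) → UnitInterval (primeProd g L)
primeProd-unit zero    u = unit-one
primeProd-unit (suc L) u with prime? (suc L)
... | yes pr = unit-* (primeProd-unit L u) (u (suc L) pr)
... | no _   = primeProd-unit L u

prime-∣-cancelʳ : ∀ {p q} → Prime p → Prime q → q ℕ.< p → ∀ m → q ∣ₙ m ℕ.* p → q ∣ₙ m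
prime-∣-cancelʳ {p} {q} prp prq q<p m q∣mp with euclidsLemma m p prq q∣mp
... | inj₁ q∣m = q∣m
... | inj₂ q∣p with prime⇒irreducible prp q∣p
...   | inj₁ refl = contradiction prq ¬prime[1]
...   | inj₂ refl = contradiction q<p (ℕₚ.<-irrefl refl)

localFactor : (ℕ → ℚ) → ℕ → ℕ → ℚ
localFactor f m p = if does (p ∣? m) then f p else 1ℚ

-- The cut-off L is independent of n: mean values are found by induction on L for all n, whereas the
-- group orders involve L = n, beyond which the product is constant.
localProduct : (ℕ → ℚ) → ℕ → ℕ → ℚ
localProduct f L n = primeProd (localFactor f n) L

localProduct-∣ : ∀ f {L n} → Prime (suc L) → suc L ∣ₙ n → localProduct f (suc L) n ≡ localProduct f L n * f (suc L)
localProduct-∣ f {L} {n} pr p∣n = trans (primeProd-prime (localFactor f n) pr)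
  (cong (λ b → localProduct f L n * (if b then f (suc L) else 1ℚ)) (dec-true (suc L ∣? n) p∣n))

localProduct-skip : ∀ f {L n} → ¬ (Prime (suc L) × suc L ∣ₙ n) → localProduct f (suc L) n ≡ localProduct f L n
localProduct-skip f {L} {n} skip = cases (prime? (suc L))
  where
  cases : Dec (Prime (suc L)) → localProduct f (suc L) n ≡ localProduct f L n
  cases (no ¬pr) = primeProd-¬prime (localFactor f n) ¬pr
  cases (yes pr) = trans (primeProd-prime (localFactor f n) pr) (trans
    (cong (λ b → localProduct f L n * (if b then f (suc L) else 1ℚ)) (dec-false (suc L ∣? n) λ p∣n → skip (pr , p∣n)))
    (ℚₚ.*-identityʳ (localProduct f L n)))

localProduct-coprime : ∀ f L {p} → Prime p → L ℕ.< p → ∀ m → localProduct f L (m ℕ.* p) ≡ localProduct f L m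
localProduct-coprime f L {p} prp L<p m = primeProd-cong L λ q prq q≤L →
  cong (λ b → if b then f q else 1ℚ)
    (does-⇔ (mk⇔ (prime-∣-cancelʳ prp prq (ℕₚ.≤-<-trans q≤L L<p) m) (∣m⇒∣m*n p)) (q ∣? m ℕ.* p) (q ∣? m))

inv-unit : ∀ n → UnitInterval (inv n)
inv-unit zero = ℚₚ.≤-refl , 0≤1
inv-unit (suc m) = 0≤inv (suc m) , (begin
  inv (suc m)                  ≡⟨ ℚₚ.*-identityˡ (inv (suc m)) ⟨
  1ℚ * inv (suc m)             ≤⟨ *-monoʳ (0≤inv (suc m)) (qN-mono (ℕ.s≤s (ℕ.z≤n {m}))) ⟩
  qN (suc m) * inv (suc m)     ≡⟨ qN*inv m ⟩
  1ℚ                           ∎)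
  where open ℚₚ.≤-Reasoning

m<[1+m/n]*n : ∀ m n .{{_ : NonZero n}} → m ℕ.< suc (m ℕ./ n) ℕ.* n
m<[1+m/n]*n m n = subst (ℕ._< suc (m ℕ./ n) ℕ.* n) (sym (m≡m%n+[m/n]*n m n)) (ℕₚ.+-monoˡ-< (m ℕ./ n ℕ.* n) (m%n<n m n))

inv-antitone : ∀ l → 0ℚ ≤ inv (suc l) - inv (suc (suc l))
inv-antitone l = subst (0ℚ ≤_) (inv-telescope l) (0≤* (0≤inv (suc l)) (0≤inv (suc (suc l))))

-- Applied with L as the index of u, to `localSum` at a fixed length and to `density`. Indices start
-- at 1, since `inv 0` is 0 by convention.
module Telescope (c : ℚ) (u : ℕ → ℚ)
  (step : ∀ l → u (suc (suc l)) ≤ u (suc l) × u (suc l) ≤ u (suc (suc l)) + c * (inv (suc l) - inv (suc (suc l)))) where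

  telescope : ∀ l d → let R = d ℕ.+ suc l in u R ≤ u (suc l) × u (suc l) ≤ u R + c * (inv (suc l) - inv R)
  telescope l zero    = ℚₚ.≤-refl , ℚₚ.≤-reflexive (lemma c (u (suc l)) (inv (suc l)))
    where
    lemma : ∀ c u v → u ≡ u + c * (v - v)
    lemma = ring-solve-∀ ℚ-ring
  telescope l (suc d) rewrite ℕₚ.+-suc d l with telescope l d
  ... | ih rewrite ℕₚ.+-suc d l with step (d ℕ.+ l)
  ...   | down , up = ℚₚ.≤-trans down (proj₁ ih) ,
          ℚₚ.≤-trans (proj₂ ih) (ℚₚ.≤-trans (ℚₚ.+-monoˡ-≤ _ up) (ℚₚ.≤-reflexive
            (lemma c (u (suc (suc (d ℕ.+ l)))) (inv (suc l)) (inv (suc (d ℕ.+ l))) (inv (suc (suc (d ℕ.+ l)))))))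
    where
    lemma : ∀ c x a b d → x + c * (b - d) + c * (a - b) ≡ x + c * (a - d)
    lemma = ring-solve-∀ ℚ-ring

  deviation : 0ℚ ≤ c → ∀ l R → suc l ℕ.≤ R → 0ℚ ≤ u (suc l) - u R × u (suc l) - u R ≤ c * inv (suc l)
  deviation 0≤c l R l<R with telescope l (R ℕ.∸ suc l)
  ... | bounds rewrite ℕₚ.m∸n+n≡m l<R = ≤⇒0≤- (proj₁ bounds) ,
        ≤-by (u R + c * (inv (suc l) - inv R) - u (suc l) + c * inv R)
          (0≤+ (≤⇒0≤- (proj₂ bounds)) (0≤* 0≤c (0≤inv R)))
          (lemma c (u (suc l)) (u R) (inv (suc l)) (inv R))
    where
    lemma : ∀ c a b x y → c * x ≡ a - b + (b + c * (x - y) - a + c * y)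
    lemma = ring-solve-∀ ℚ-ring

-- Mean value of local products up to a cut-off

∣∣≤-unit : ∀ {x D} b → UnitInterval x → ∣ b ∣ ≤ D → ∣ x * b ∣ ≤ D
∣∣≤-unit {x} {D} b (0≤x , x≤1) b≤D = begin
  ∣ x * b ∣        ≡⟨ ℚₚ.∣p*q∣≡∣p∣*∣q∣ x b ⟩
  ∣ x ∣ * ∣ b ∣    ≡⟨ cong (_* ∣ b ∣) (ℚₚ.0≤p⇒∣p∣≡p 0≤x) ⟩
  x * ∣ b ∣        ≤⟨ *-monoʳ (ℚₚ.0≤∣p∣ b) x≤1 ⟩
  1ℚ * ∣ b ∣       ≡⟨ ℚₚ.*-identityˡ _ ⟩
  ∣ b ∣            ≤⟨ b≤D ⟩
  D                ∎
  where open ℚₚ.≤-Reasoning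

∣∣≤-nonneg : ∀ {x D} → 0ℚ ≤ x → x ≤ D → ∣ x ∣ ≤ D
∣∣≤-nonneg {D = D} 0≤x x≤D = subst (_≤ D) (sym (ℚₚ.0≤p⇒∣p∣≡p 0≤x)) x≤D

∣∣≤-+ : ∀ {x y D E} → ∣ x ∣ ≤ D → ∣ y ∣ ≤ E → ∣ x + y ∣ ≤ D + E
∣∣≤-+ {x} {y} x≤D y≤E = ℚₚ.≤-trans (ℚₚ.∣p+q∣≤∣p∣+∣q∣ x y) (ℚₚ.+-mono-≤ x≤D y≤E)

∣∣≤-- : ∀ {x y D E} → ∣ x ∣ ≤ D → ∣ y ∣ ≤ E → ∣ x - y ∣ ≤ D + E
∣∣≤-- {x} {y} x≤D y≤E = ℚₚ.≤-trans (ℚₚ.∣p-q∣≤∣p∣+∣q∣ x y) (ℚₚ.+-mono-≤ x≤D y≤E)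

floor-bounds : ∀ p-1 n q → q ℕ.* suc p-1 ℕ.≤ n → n ℕ.< suc q ℕ.* suc p-1 →
  UnitInterval (qN n * inv (suc p-1) - qN q)
floor-bounds p-1 n q lo hi =
  ≤⇒0≤- (subst (_≤ qN n * v) (qp*v q) (*-monoʳ (0≤inv (suc p-1)) (qN-mono lo))) ,
  ≤-by (qN (suc q) - qN n * v)
    (≤⇒0≤- (subst (qN n * v ≤_) (qp*v (suc q)) (*-monoʳ (0≤inv (suc p-1)) (qN-mono (ℕₚ.<⇒≤ hi)))))
    (trans (lemma (qN q) (qN n * v)) (cong (λ x → qN n * v - qN q + (x - qN n * v)) (sym (qN-+ 1 q))))
  where
  v = inv (suc p-1)
  qp*v : ∀ q → qN (q ℕ.* suc p-1) * v ≡ qN q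
  qp*v q = begin
    qN (q ℕ.* suc p-1) * v        ≡⟨ cong (_* v) (qN-* q (suc p-1)) ⟩
    qN q * qN (suc p-1) * v       ≡⟨ ℚₚ.*-assoc (qN q) (qN (suc p-1)) v ⟩
    qN q * (qN (suc p-1) * v)     ≡⟨ cong (qN q *_) (qN*inv p-1) ⟩
    qN q * 1ℚ                     ≡⟨ ℚₚ.*-identityʳ (qN q) ⟩
    qN q                          ∎
    where open ≡-Reasoning
  lemma : ∀ q x → 1ℚ ≡ x - q + (1ℚ + q - x)
  lemma = ring-solve-∀ ℚ-ring

-- Equal to 2^L - 1: a prime combines the old errors at n and at ⌊n/p⌋ and adds a rounding error of
-- at most 1. The growth is harmless because L is fixed before n.
errorBound : ℕ → ℕ
errorBound zero    = 0
errorBound (suc L) = errorBound L ℕ.+ errorBound L ℕ.+ 1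

module MeanValue (f : ℕ → ℚ) (f-unit : ∀ l → UnitInterval (f (suc (suc l))))
  (f-near-one : ∀ l → 1ℚ - f (suc (suc l)) ≤ inv (suc l)) where

  f-unit-prime : ∀ p → Prime p → UnitInterval (f p)
  f-unit-prime zero          pr = contradiction pr ¬prime[0]
  f-unit-prime (suc zero)    pr = contradiction pr ¬prime[1]
  f-unit-prime (suc (suc l)) pr = f-unit l

  localProduct-unit : ∀ L m → UnitInterval (localProduct f L m)
  localProduct-unit L m = primeProd-unit L λ p pr → unit-if (does (p ∣? m)) (f-unit-prime p pr) unit-one

  localSum : ℕ → ℕ → ℚ
  localSum L n = partial (localProduct f L) n

  localSum-bounds : ∀ L n → 0ℚ ≤ localSum L n × localSum L n ≤ qN n
  localSum-bounds L n = partial-nonneg n (λ m → proj₁ (localProduct-unit L m)) ,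
    subst (localSum L n ≤_) (partial-one n) (partial-mono n λ m → proj₂ (localProduct-unit L m))

  -- The average of the factor at p, which is f p on a proportion 1/p of the integers and 1 on the
  -- rest.
  meanFactor : ℕ → ℚ
  meanFactor p = 1ℚ - inv p * (1ℚ - f p)

  density : ℕ → ℚ
  density L = primeProd meanFactor L

  density-unit : ∀ L → UnitInterval (density L)
  density-unit L = primeProd-unit L λ p pr → unit-complement (unit-* (inv-unit p) (unit-complement (f-unit-prime p pr)))

  -- The new factor is 1 minus (1 - f p) times the indicator of p ∣ m. The correction is thus a sum
  -- over m = j p, and the primes up to L divide j p exactly when they divide j.
  localSum-prime : ∀ {L} → Prime (suc L) → ∀ n q → q ℕ.* suc L ℕ.≤ n → n ℕ.< suc q ℕ.* suc L →
    localSum (suc L) n ≡ localSum L n - (1ℚ - f (suc L)) * localSum L q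
  localSum-prime {L} pr n q lo hi = begin
    partial (localProduct f (suc L)) n
      ≡⟨ partial-cong n (λ m _ → split (suc m)) ⟩
    partial (λ m → localProduct f L m - (1ℚ - f (suc L)) * onMultiples m) n
      ≡⟨ partial-linear (1ℚ - f (suc L)) (localProduct f L) onMultiples n ⟩
    localSum L n - (1ℚ - f (suc L)) * partial onMultiples n
      ≡⟨ cong (λ x → localSum L n - (1ℚ - f (suc L)) * x) (trans
           (partial-multiples (suc L) (λ m p∤m → cong (λ b → if b then localProduct f L m else 0ℚ) (dec-false (suc L ∣? m) p∤m)) n q lo hi)
           (partial-cong q λ j _ → trans
             (cong (λ b → if b then localProduct f L (suc j ℕ.* suc L) else 0ℚ) (dec-true (suc L ∣? suc j ℕ.* suc L) (n∣m*n (suc j))))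
             (localProduct-coprime f L pr ℕₚ.≤-refl (suc j)))) ⟩
    localSum L n - (1ℚ - f (suc L)) * localSum L q ∎
    where
    open ≡-Reasoning
    onMultiples : ℕ → ℚ
    onMultiples m = if does (suc L ∣? m) then localProduct f L m else 0ℚ
    divisible : ∀ g x → g * x ≡ g - (1ℚ - x) * g
    divisible = ring-solve-∀ ℚ-ring
    indivisible : ∀ g x → g * 1ℚ ≡ g - (1ℚ - x) * 0ℚ
    indivisible = ring-solve-∀ ℚ-ring
    split : ∀ m → localProduct f (suc L) m ≡ localProduct f L m - (1ℚ - f (suc L)) * onMultiples m
    split m = trans (primeProd-prime (localFactor f m) pr) (cases (does (suc L ∣? m)))
      where
      cases : ∀ b → localProduct f L m * (if b then f (suc L) else 1ℚ) ≡
        localProduct f L m - (1ℚ - f (suc L)) * (if b then localProduct f L m else 0ℚ)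
      cases true  = divisible (localProduct f L m) (f (suc L))
      cases false = indivisible (localProduct f L m) (f (suc L))

  localSum-¬prime : ∀ {L} → ¬ Prime (suc L) → ∀ n → localSum (suc L) n ≡ localSum L n
  localSum-¬prime ¬pr n = partial-cong n λ m _ → localProduct-skip f λ (pr , _) → ¬pr pr

  localSum-density : ∀ L n → ∣ localSum L n - density L * qN n ∣ ≤ qN (errorBound L)
  localSum-density zero n = ℚₚ.≤-reflexive (cong ∣_∣ (trans (cong (_- 1ℚ * qN n) (partial-one n)) (lemma (qN n))))
    where
    lemma : ∀ x → x - 1ℚ * x ≡ 0ℚ
    lemma = ring-solve-∀ ℚ-ring
  localSum-density (suc L) n = cases (prime? (suc L))
    where
    cases : Dec (Prime (suc L)) → ∣ localSum (suc L) n - density (suc L) * qN n ∣ ≤ qN (errorBound (suc L))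
    cases (no ¬pr) = subst₂ (λ x y → ∣ x - y * qN n ∣ ≤ qN (errorBound (suc L)))
      (sym (localSum-¬prime ¬pr n)) (sym (primeProd-¬prime meanFactor ¬pr))
      (ℚₚ.≤-trans (localSum-density L n) (qN-mono
        (ℕₚ.≤-trans (ℕₚ.m≤m+n (errorBound L) (errorBound L)) (ℕₚ.m≤m+n (errorBound L ℕ.+ errorBound L) 1))))
    cases (yes pr) = begin
      ∣ localSum (suc L) n - density (suc L) * qN n ∣
        ≡⟨ cong ∣_∣ (trans (cong₂ (λ a b → a - b * qN n) (localSum-prime pr n q lo hi) (primeProd-prime meanFactor pr))
                           (lemma (localSum L n) (localSum L q) P v x (qN n) (qN q))) ⟩
      -- The old error at n, the old error at q weighted by x ≤ 1, and the rounding of n / p to q.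
      ∣ (localSum L n - P * qN n) - x * (localSum L q - P * qN q) + x * P * (qN n * v - qN q) ∣
        ≤⟨ ∣∣≤-+ (∣∣≤-- (localSum-density L n) (∣∣≤-unit (localSum L q - P * qN q) x-unit (localSum-density L q)))
                 (∣∣≤-nonneg (proj₁ rest) (proj₂ rest)) ⟩
      qN (errorBound L) + qN (errorBound L) + qN 1
        ≡⟨ trans (qN-+ (errorBound L ℕ.+ errorBound L) 1) (cong (_+ qN 1) (qN-+ (errorBound L) (errorBound L))) ⟨
      qN (errorBound (suc L)) ∎
      where
      open ℚₚ.≤-Reasoning
      q = n ℕ./ suc L
      lo = m/n*n≤m n (suc L)
      hi = m<[1+m/n]*n n (suc L)
      P = density L
      v = inv (suc L)
      x = 1ℚ - f (suc L)
      x-unit = unit-complement (f-unit-prime (suc L) pr)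
      rest = unit-* (unit-* x-unit (density-unit L)) (floor-bounds L n q lo hi)
      lemma : ∀ a b P v x n q → a - x * b - P * (1ℚ - v * x) * n ≡ (a - P * n) - x * (b - P * q) + x * P * (n * v - q)
      lemma = ring-solve-∀ ℚ-ring

-- Cesàro equivalence of multiplicative sequences

-- By Abel summation the difference is minus the sum of the increments of w times the partial sums
-- of b; the increments are nonnegative and add up to at most w n. Here the identity is unrolled by
-- induction.
abel-bound : ∀ (w b : ℕ → ℚ) T → 0ℚ ≤ w 0 → (∀ m → w m ≤ w (suc m)) → ∀ n → (∀ j → j ℕ.≤ n → ∣ partial b j ∣ ≤ T) →
  ∣ partial (λ m → w m * b m) n - w n * partial b n ∣ ≤ w n * T
abel-bound w b T 0≤w0 mono zero bound =
  subst (_≤ w 0 * T) (cong ∣_∣ (lemma (w 0))) (0≤* 0≤w0 (ℚₚ.≤-trans (ℚₚ.0≤∣p∣ 0ℚ) (bound 0 ℕ.z≤n)))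
  where
  lemma : ∀ w → 0ℚ ≡ 0ℚ - w * 0ℚ
  lemma = ring-solve-∀ ℚ-ring
abel-bound w b T 0≤w0 mono (suc n) bound = begin
  ∣ S + w′ * b′ - w′ * (B + b′) ∣         ≡⟨ cong ∣_∣ (lemma S B b′ (w n) w′) ⟩
  ∣ (S - w n * B) - (w′ - w n) * B ∣
    ≤⟨ ∣∣≤-- (abel-bound w b T 0≤w0 mono n λ j j≤n → bound j (ℕₚ.m≤n⇒m≤1+n j≤n)) second ⟩
  w n * T + (w′ - w n) * T                ≡⟨ lemma′ (w n) w′ T ⟩
  w′ * T                                  ∎
  where
  open ℚₚ.≤-Reasoning
  S = partial (λ m → w m * b m) n
  B = partial b n
  b′ = b (suc n)
  w′ = w (suc n)
  second : ∣ (w′ - w n) * B ∣ ≤ (w′ - w n) * T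
  second = begin
    ∣ (w′ - w n) * B ∣        ≡⟨ ℚₚ.∣p*q∣≡∣p∣*∣q∣ (w′ - w n) B ⟩
    ∣ w′ - w n ∣ * ∣ B ∣      ≡⟨ cong (_* ∣ B ∣) (ℚₚ.0≤p⇒∣p∣≡p (≤⇒0≤- (mono n))) ⟩
    (w′ - w n) * ∣ B ∣        ≤⟨ *-monoˡ (≤⇒0≤- (mono n)) (bound n (ℕₚ.n≤1+n n)) ⟩
    (w′ - w n) * T            ∎
  lemma : ∀ S B b w w′ → S + w′ * b - w′ * (B + b) ≡ (S - w * B) - (w′ - w) * B
  lemma = ring-solve-∀ ℚ-ring
  lemma′ : ∀ w w′ T → w * T + (w′ - w) * T ≡ w′ * T
  lemma′ = ring-solve-∀ ℚ-ring

weighted-sum-bound : ∀ (w b : ℕ → ℚ) T → 0ℚ ≤ w 0 → (∀ m → w m ≤ w (suc m)) → ∀ n →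
  (∀ j → j ℕ.≤ n → ∣ partial b j ∣ ≤ T) → ∣ partial (λ m → w m * b m) n ∣ ≤ w n * T + w n * T
weighted-sum-bound w b T 0≤w0 mono n bound = begin
  ∣ S ∣                        ≡⟨ cong ∣_∣ (lemma S (w n * B)) ⟩
  ∣ (S - w n * B) + w n * B ∣   ≤⟨ ∣∣≤-+ (abel-bound w b T 0≤w0 mono n bound) second ⟩
  w n * T + w n * T            ∎
  where
  open ℚₚ.≤-Reasoning
  S = partial (λ m → w m * b m) n
  B = partial b n
  0≤w : ∀ m → 0ℚ ≤ w m
  0≤w zero    = 0≤w0
  0≤w (suc m) = ℚₚ.≤-trans (0≤w m) (mono m)
  second : ∣ w n * B ∣ ≤ w n * T
  second = begin
    ∣ w n * B ∣        ≡⟨ ℚₚ.∣p*q∣≡∣p∣*∣q∣ (w n) B ⟩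
    ∣ w n ∣ * ∣ B ∣    ≡⟨ cong (_* ∣ B ∣) (ℚₚ.0≤p⇒∣p∣≡p (0≤w n)) ⟩
    w n * ∣ B ∣        ≤⟨ *-monoˡ (0≤w n) (bound n ℕₚ.≤-refl) ⟩
    w n * T            ∎
  lemma : ∀ s x → s ≡ s - x + x
  lemma = ring-solve-∀ ℚ-ring

-- The mean value inequality for x^(K+1) on [n, n + 1], in a form free of subtraction.
suc-^-bound : ∀ K n → suc n ℕ.^ suc K ℕ.≤ n ℕ.^ suc K ℕ.+ suc K ℕ.* suc n ℕ.^ K
suc-^-bound zero    n = ℕₚ.≤-reflexive (lemma n)
  where
  lemma : ∀ n → suc n ℕ.* 1 ≡ n ℕ.* 1 ℕ.+ 1
  lemma = ℕ-solve-∀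
suc-^-bound (suc K) n = begin
  x ℕ.+ n ℕ.* x                                          ≤⟨ ℕₚ.+-monoʳ-≤ x (ℕₚ.*-monoʳ-≤ n (suc-^-bound K n)) ⟩
  x ℕ.+ n ℕ.* (n ℕ.^ suc K ℕ.+ suc K ℕ.* y)              ≡⟨ lemma x n (n ℕ.^ suc K) (suc K) y ⟩
  n ℕ.* n ℕ.^ suc K ℕ.+ (x ℕ.+ suc K ℕ.* (n ℕ.* y))
    ≤⟨ ℕₚ.+-monoʳ-≤ (n ℕ.* n ℕ.^ suc K) (ℕₚ.+-monoʳ-≤ x (ℕₚ.*-monoʳ-≤ (suc K) (ℕₚ.m≤n+m (n ℕ.* y) y))) ⟩
  n ℕ.* n ℕ.^ suc K ℕ.+ (x ℕ.+ suc K ℕ.* x)              ∎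
  where
  open ℕₚ.≤-Reasoning
  x = suc n ℕ.^ suc K
  y = suc n ℕ.^ K
  lemma : ∀ x n p k y → x ℕ.+ n ℕ.* (p ℕ.+ k ℕ.* y) ≡ n ℕ.* p ℕ.+ (x ℕ.+ k ℕ.* (n ℕ.* y))
  lemma = ℕ-solve-∀

-- Abel summation leaves an error of order n · n^K; this converts it into a multiple of the
-- normalising sum.
power-sum-bound : ∀ K n → n ℕ.^ suc K ℕ.≤ suc K ℕ.* sumTo (ℕ._^ K) n
power-sum-bound K zero    = ℕ.z≤n
power-sum-bound K (suc n) = begin
  suc n ℕ.^ suc K                                             ≤⟨ suc-^-bound K n ⟩
  n ℕ.^ suc K ℕ.+ suc K ℕ.* suc n ℕ.^ K                       ≤⟨ ℕₚ.+-monoˡ-≤ _ (power-sum-bound K n) ⟩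
  suc K ℕ.* sumTo (ℕ._^ K) n ℕ.+ suc K ℕ.* suc n ℕ.^ K
    ≡⟨ ℕₚ.*-distribˡ-+ (suc K) (sumTo (ℕ._^ K) n) (suc n ℕ.^ K) ⟨
  suc K ℕ.* sumTo (ℕ._^ K) (suc n)                            ∎
  where open ℕₚ.≤-Reasoning

-- The numerator of a positive fraction is at least 1, so the reciprocal of its own denominator will
-- do.
inv-below : ∀ ε → 0ℚ < ε → Σ ℕ λ d → inv (suc d) ≤ ε
inv-below ε@(ℚ.mkℚ +[1+ a ] d _) _ = d , ℚₚ.toℚᵘ-cancel-≤
  (ℚᵘₚ.≤-respˡ-≃ (ℚᵘₚ.≃-sym (ℚₚ.toℚᵘ-fromℚᵘ (mkℚᵘ (+ 1) d)))
    (*≤* (ℤₚ.*-monoʳ-≤-nonNeg (+ suc d) (ℤ.+≤+ (ℕ.s≤s (ℕ.z≤n {a}))))))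
inv-below (ℚ.mkℚ +0 d _)        0<ε with ℚₚ.drop-*<* 0<ε
... | ℤ.+<+ ()
inv-below (ℚ.mkℚ -[1+ a ] d _)  0<ε with ℚₚ.drop-*<* 0<ε
... | ()

archimedean : ∀ c ε → 0ℚ < ε → Σ ℕ λ l → qN c * inv (suc l) ≤ ε
archimedean c ε 0<ε with inv-below ε 0<ε
-- The witness l is chosen so that l + 1 = (c + 1)(d + 1).
... | d , 1/d≤ε = d ℕ.+ c ℕ.* suc d , (begin
  qN c * inv (suc c ℕ.* suc d)                 ≤⟨ *-monoʳ (0≤inv (suc c ℕ.* suc d)) (qN-mono (ℕₚ.n≤1+n c)) ⟩
  qN (suc c) * inv (suc c ℕ.* suc d)           ≡⟨ cong (qN (suc c) *_) (inv-* (suc c) (suc d)) ⟩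
  qN (suc c) * (inv (suc c) * inv (suc d))     ≡⟨ ℚₚ.*-assoc (qN (suc c)) (inv (suc c)) (inv (suc d)) ⟨
  qN (suc c) * inv (suc c) * inv (suc d)       ≡⟨ cong (_* inv (suc d)) (qN*inv c) ⟩
  1ℚ * inv (suc d)                             ≡⟨ ℚₚ.*-identityˡ (inv (suc d)) ⟩
  inv (suc d)                                  ≤⟨ 1/d≤ε ⟩
  ε                                            ∎)
  where open ℚₚ.≤-Reasoning

archimedean₃ : ∀ a b c ε → 0ℚ < ε → Σ ℕ λ l → qN a * qN b * qN c * inv (suc l) ≤ ε
archimedean₃ a b c ε 0<ε = proj₁ bound , subst (λ x → x * inv (suc (proj₁ bound)) ≤ ε) split (proj₂ bound)
  where
  bound : Σ ℕ λ l → qN (a ℕ.* b ℕ.* c) * inv (suc l) ≤ ε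
  bound = archimedean (a ℕ.* b ℕ.* c) ε 0<ε
  split : qN (a ℕ.* b ℕ.* c) ≡ qN a * qN b * qN c
  split = trans (qN-* (a ℕ.* b) c) (cong (_* qN c) (qN-* a b))

-- The closing computation of `cesaro`, with its numerals as letters: a = 3, b = 6, c = 4, i = 1/4.
-- The factor c i = 1 is inserted so that i can be replaced by the larger P.
error-estimate : ∀ {w n k Y u P ε a b c i} → 0ℚ ≤ u → 0ℚ ≤ Y → 0ℚ ≤ ε → 0ℚ ≤ b → 0ℚ ≤ i → a + a ≡ b → c * i ≡ 1ℚ →
  n * w ≤ k * Y → b * k * c * u ≤ ε → i ≤ P →
  w * (a * (n * u)) + w * (a * (n * u)) ≤ ε * P * Y
error-estimate {w} {n} {k} {Y} {u} {P} {ε} {a} {b} {c} {i} 0≤u 0≤Y 0≤ε 0≤b 0≤i a+a≡b ci≡1 nw≤kY small i≤P = begin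
  w * (a * (n * u)) + w * (a * (n * u))     ≡⟨ collect w n u a ⟩
  (a + a) * (n * w) * u                     ≡⟨ cong (λ b → b * (n * w) * u) a+a≡b ⟩
  b * (n * w) * u                           ≤⟨ *-monoʳ 0≤u (*-monoˡ 0≤b nw≤kY) ⟩
  b * (k * Y) * u                           ≡⟨ ℚₚ.*-identityʳ _ ⟨
  b * (k * Y) * u * 1ℚ                      ≡⟨ cong (b * (k * Y) * u *_) ci≡1 ⟨
  b * (k * Y) * u * (c * i)                 ≡⟨ rearrange b k Y u c i ⟩
  b * k * c * u * i * Y                     ≤⟨ *-monoʳ 0≤Y (*-mono 0≤i 0≤ε small i≤P) ⟩
  ε * P * Y                                 ∎
  where
  open ℚₚ.≤-Reasoning
  collect : ∀ w n u a → w * (a * (n * u)) + w * (a * (n * u)) ≡ (a + a) * (n * w) * u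
  collect = ring-solve-∀ ℚ-ring
  rearrange : ∀ b k Y u c i → b * (k * Y) * u * (c * i) ≡ b * k * c * u * i * Y
  rearrange = ring-solve-∀ ℚ-ring

module Cesaro (f : ℕ → ℚ) (f-unit : ∀ l → UnitInterval (f (suc (suc l))))
  (f-near-one : ∀ l → 1ℚ - f (suc (suc l)) ≤ inv (suc l)) where

  open MeanValue f f-unit f-near-one

  private
    Slow : ℚ → ℚ → ℚ → ℕ → Set
    Slow c a a′ l = a′ ≤ a × a ≤ a′ + c * (inv (suc l) - inv (suc (suc l)))

    slow-stays : ∀ {c} a l → 0ℚ ≤ c → Slow c a a l
    slow-stays {c} a l 0≤c = ℚₚ.≤-refl , ≤-by (c * (inv (suc l) - inv (suc (suc l)))) (0≤* 0≤c (inv-antitone l)) refl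

    slow-drops : ∀ {c} a d l → 0ℚ ≤ d → d ≤ c * (inv (suc l) * inv (suc (suc l))) → Slow c a (a - d) l
    slow-drops {c} a d l 0≤d d≤ = ≤-by d 0≤d (lemma a d) ,
      ≤-by (c * (inv (suc l) - inv (suc (suc l))) - d)
        (≤⇒0≤- (subst (λ x → d ≤ c * x) (inv-telescope l) d≤))
        (lemma′ a d (c * (inv (suc l) - inv (suc (suc l)))))
      where
      lemma : ∀ a d → a ≡ a - d + d
      lemma = ring-solve-∀ ℚ-ring
      lemma′ : ∀ a d c → a - d + c ≡ a + (c - d)
      lemma′ = ring-solve-∀ ℚ-ring

  -- At a prime p the loss is 1 - f p times a sum of ⌊n/p⌋ terms from the unit interval, hence at
  -- most n / ((p - 1) p).
  localSum-slow : ∀ n l → Slow (qN n) (localSum (suc l) n) (localSum (suc (suc l)) n) l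
  localSum-slow n l = cases (prime? (suc (suc l)))
    where
    cases : Dec (Prime (suc (suc l))) → Slow (qN n) (localSum (suc l) n) (localSum (suc (suc l)) n) l
    cases (no ¬pr) = subst (λ a → Slow (qN n) (localSum (suc l) n) a l) (sym (localSum-¬prime ¬pr n))
      (slow-stays (localSum (suc l) n) l (0≤qN n))
    cases (yes pr) = subst (λ a → Slow (qN n) (localSum (suc l) n) a l) (sym (localSum-prime pr n q lo hi))
      (slow-drops {qN n} (localSum (suc l) n) (x * localSum (suc l) q) l (0≤* (proj₁ x-unit) (proj₁ bounds)) (begin
        x * localSum (suc l) q          ≤⟨ *-mono (proj₁ bounds) (0≤inv (suc l)) (f-near-one l) q≤nv ⟩
        inv (suc l) * (qN n * v)       ≡⟨ lemma (inv (suc l)) (qN n) v ⟩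
        qN n * (inv (suc l) * v)       ∎))
      where
      open ℚₚ.≤-Reasoning
      q = n ℕ./ suc (suc l)
      lo = m/n*n≤m n (suc (suc l))
      hi = m<[1+m/n]*n n (suc (suc l))
      v = inv (suc (suc l))
      x = 1ℚ - f (suc (suc l))
      x-unit = unit-complement (f-unit l)
      bounds = localSum-bounds (suc l) q
      eq : ∀ a b → b ≡ a + (b - a)
      eq = ring-solve-∀ ℚ-ring
      q≤nv : localSum (suc l) q ≤ qN n * v
      q≤nv = ℚₚ.≤-trans (proj₂ bounds)
        (≤-by (qN n * v - qN q) (proj₁ (floor-bounds (suc l) n q lo hi)) (eq (qN q) (qN n * v)))
      lemma : ∀ u n v → u * (n * v) ≡ n * (u * v)
      lemma = ring-solve-∀ ℚ-ring

  density-slow : ∀ l → Slow 1ℚ (density (suc l)) (density (suc (suc l))) l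
  density-slow l = cases (prime? (suc (suc l)))
    where
    cases : Dec (Prime (suc (suc l))) → Slow 1ℚ (density (suc l)) (density (suc (suc l))) l
    cases (no ¬pr) = subst (λ a → Slow 1ℚ (density (suc l)) a l) (sym (primeProd-¬prime meanFactor ¬pr))
      (slow-stays (density (suc l)) l 0≤1)
    cases (yes pr) = subst (λ a → Slow 1ℚ P a l) (trans (lemma P v x) (sym (primeProd-prime meanFactor pr)))
      (slow-drops {1ℚ} P (P * (v * x)) l (0≤* (proj₁ P-unit) 0≤vx)
        (*-mono 0≤vx 0≤1 (proj₂ P-unit) (subst (_≤ inv (suc l) * v) (ℚₚ.*-comm x v) (*-monoʳ (0≤inv (suc (suc l))) (f-near-one l)))))
      where
      P = density (suc l)
      P-unit = density-unit (suc l)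
      v = inv (suc (suc l))
      x = 1ℚ - f (suc (suc l))
      0≤vx = 0≤* (0≤inv (suc (suc l))) (proj₁ (unit-complement (f-unit l)))
      lemma : ∀ P v x → P - P * (v * x) ≡ P * (1ℚ - v * x)
      lemma = ring-solve-∀ ℚ-ring

  -- The constant 4 comes from here: the factor at 2 may be as small as 1/2, and then both sides
  -- equal 2.
  density-2 : qN 1 + qN 2 * inv 2 ≤ qN 4 * density 2
  density-2 = ≤-by (qN 2 * (1ℚ - x)) (0≤* (0≤qN 2) (≤⇒0≤- (proj₂ (unit-complement (f-unit 0)))))
    (trans (cong (qN 4 *_) (trans (primeProd-prime meanFactor prime[2]) (cong (_* (1ℚ - inv 2 * x)) (primeProd-¬prime meanFactor ¬prime[1]))))
           (lemma x))
    where
    x = 1ℚ - f 2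
    lemma : ∀ x → qN 4 * (1ℚ * (1ℚ - inv 2 * x)) ≡ qN 1 + qN 2 * inv 2 + qN 2 * (1ℚ - x)
    lemma = ring-solve-∀ ℚ-ring

  -- The slack 2/R pays for the later factors, which lose at most 1/R - 1/(R+1) each.
  density-lower : ∀ r → qN 1 + qN 2 * inv (suc (suc r)) ≤ qN 4 * density (suc (suc r))
  density-lower zero    = density-2
  density-lower (suc r) = cases (prime? (suc (suc (suc r))))
    where
    open ℚₚ.≤-Reasoning
    u = inv (suc (suc r))
    v = inv (suc (suc (suc r)))
    P = density (suc (suc r))
    x = 1ℚ - f (suc (suc (suc r)))
    x-unit = unit-complement (f-unit (suc r))
    0≤u-v : 0ℚ ≤ u - v
    0≤u-v = inv-antitone (suc r)
    2u≤1 : qN 2 * u ≤ qN 1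
    2u≤1 = subst (qN 2 * u ≤_) (qN*inv (suc r)) (*-monoʳ (0≤inv (suc (suc r))) (qN-mono (ℕ.s≤s (ℕ.s≤s (ℕ.z≤n {r})))))
    vx≤u-v : v * x ≤ u - v
    vx≤u-v = begin
      v * x    ≤⟨ *-monoˡ (0≤inv (suc (suc (suc r)))) (f-near-one (suc r)) ⟩
      v * u    ≡⟨ ℚₚ.*-comm v u ⟩
      u * v    ≡⟨ inv-telescope (suc r) ⟩
      u - v    ∎
    stay : ∀ u v → qN 1 + qN 2 * u ≡ qN 1 + qN 2 * v + qN 2 * (u - v)
    stay = ring-solve-∀ ℚ-ring
    -- With y = v x, the summands after 1 + 2 v are nonnegative in turn by v ≤ u and 2 u ≤ 1, by y ≤
    -- u - v, and by the induction hypothesis with y ≤ 1.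
    drop : ∀ P u v y → qN 4 * (P * (1ℚ - y)) ≡ qN 1 + qN 2 * v +
      ((u - v) * (1ℚ - qN 2 * u) + ((qN 1 + qN 2 * u) * (u - v - y) + (qN 4 * P - (qN 1 + qN 2 * u)) * (1ℚ - y)))
    drop = ring-solve-∀ ℚ-ring
    ih : qN 1 + qN 2 * u ≤ qN 4 * P
    ih = density-lower r
    cases : Dec (Prime (suc (suc (suc r)))) → qN 1 + qN 2 * v ≤ qN 4 * density (suc (suc (suc r)))
    cases (no ¬pr) = subst (λ a → qN 1 + qN 2 * v ≤ qN 4 * a) (sym (primeProd-¬prime meanFactor ¬pr))
      (ℚₚ.≤-trans (≤-by (qN 2 * (u - v)) (0≤* (0≤qN 2) 0≤u-v) (stay u v)) ih)
    cases (yes pr) = subst (λ a → qN 1 + qN 2 * v ≤ qN 4 * a) (sym (primeProd-prime meanFactor pr))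
      (≤-by _ (0≤+ (0≤* 0≤u-v (≤⇒0≤- 2u≤1)) (0≤+ (0≤* (0≤+ (0≤qN 1) (0≤* (0≤qN 2) (0≤inv (suc (suc r))))) (≤⇒0≤- vx≤u-v))
          (0≤* (≤⇒0≤- ih) (≤⇒0≤- (proj₂ (unit-* (inv-unit (suc (suc (suc r)))) x-unit))))))
        (drop P u v (v * x)))

  -- Needed because the tolerance in `CesaroEquivProd` is ε times P M: an absolute error is
  -- converted into a relative one, uniformly in M.
  density-positive : ∀ M → inv 4 ≤ density M
  density-positive zero = *-mono {inv 4} {1ℚ} {1ℚ} {1ℚ} 0≤1 0≤1 (proj₂ (inv-unit 4)) ℚₚ.≤-refl
  density-positive (suc zero) = subst (inv 4 ≤_) (sym (primeProd-¬prime meanFactor ¬prime[1])) (density-positive zero)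
  density-positive (suc (suc r)) = begin
    inv 4
      ≤⟨ ≤-by (inv 4 * (qN 2 * v)) (0≤* (0≤inv 4) (0≤* (0≤qN 2) (0≤inv (suc (suc r))))) (lemma v) ⟩
    inv 4 * (qN 1 + qN 2 * v)                      ≤⟨ *-monoˡ (0≤inv 4) (density-lower r) ⟩
    inv 4 * (qN 4 * density (suc (suc r)))         ≡⟨ lemma′ (density (suc (suc r))) ⟩
    density (suc (suc r))                          ∎
    where
    open ℚₚ.≤-Reasoning
    v = inv (suc (suc r))
    lemma : ∀ v → inv 4 * (qN 1 + qN 2 * v) ≡ inv 4 + inv 4 * (qN 2 * v)
    lemma = ring-solve-∀ ℚ-ring
    lemma′ : ∀ d → inv 4 * (qN 4 * d) ≡ d
    lemma′ = ring-solve-∀ ℚ-ring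

  localProduct-stable : ∀ m d → localProduct f (d ℕ.+ suc m) (suc m) ≡ localProduct f (suc m) (suc m)
  localProduct-stable m zero    = refl
  localProduct-stable m (suc d) = trans
    (localProduct-skip f λ (_ , p∣m) → >⇒∤ (ℕ.s≤s (ℕₚ.m≤n+m (suc m) d)) p∣m) (localProduct-stable m d)

  -- The cut-off stays n for every j ≤ n, since Abel summation wants one fixed sequence with all its
  -- partial sums bounded.
  partial-deviation : ∀ l n M j → suc l ℕ.≤ n → suc l ℕ.≤ M → j ℕ.≤ n →
    suc l ℕ.* errorBound (suc l) ℕ.≤ n →
    ∣ partial (λ m → localProduct f n m - density M) j ∣ ≤ qN 3 * (qN n * inv (suc l))
  partial-deviation l n M j l<n l<M j≤n big = begin
    ∣ partial (λ m → localProduct f n m - density M) j ∣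
      ≡⟨ cong ∣_∣ (trans (partial-cong j λ m _ → cong (λ x → localProduct f n (suc m) - x) (sym (ℚₚ.*-identityʳ (density M))))
           (trans (partial-linear (density M) (localProduct f n) (λ _ → 1ℚ) j)
             (trans (cong (λ x → localSum n j - density M * x) (partial-one j))
               (split (localSum n j) (localSum (suc l) j) (density (suc l)) (density M) (qN j))))) ⟩
    -- With L = l + 1: the mean value error at L, then the losses of the sum and of the product
    -- beyond L. Each is at most n / L, the first by the hypothesis `big`.
    ∣ (localSum (suc l) j - density (suc l) * qN j) - (localSum (suc l) j - localSum n j) + (density (suc l) - density M) * qN j ∣
      ≤⟨ ∣∣≤-+ (∣∣≤-- error₁ (∣∣≤-nonneg (proj₁ dev₁) error₂))
               (∣∣≤-nonneg (0≤* (proj₁ dev₂) (0≤qN j)) error₃) ⟩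
    nu + nu + nu
      ≡⟨ triple nu ⟩
    qN 3 * nu ∎
    where
    open ℚₚ.≤-Reasoning
    u = inv (suc l)
    nu = qN n * u
    dev₁ = Telescope.deviation (qN j) (λ L → localSum L j) (localSum-slow j) (0≤qN j) l n l<n
    dev₂ = Telescope.deviation 1ℚ density density-slow 0≤1 l M l<M
    split : ∀ a b p q j → a - q * j ≡ (b - p * j) - (b - a) + (p - q) * j
    split = ring-solve-∀ ℚ-ring
    triple : ∀ x → x + x + x ≡ qN 3 * x
    triple = ring-solve-∀ ℚ-ring
    error₁ : ∣ localSum (suc l) j - density (suc l) * qN j ∣ ≤ nu
    error₁ = begin
      ∣ localSum (suc l) j - density (suc l) * qN j ∣   ≤⟨ localSum-density (suc l) j ⟩
      qN E                                             ≡⟨ ℚₚ.*-identityˡ (qN E) ⟨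
      1ℚ * qN E                                        ≡⟨ cong (_* qN E) (qN*inv l) ⟨
      qN (suc l) * u * qN E                            ≡⟨ swap (qN (suc l)) u (qN E) ⟩
      qN (suc l) * qN E * u                            ≡⟨ cong (_* u) (qN-* (suc l) E) ⟨
      qN (suc l ℕ.* E) * u                             ≤⟨ *-monoʳ (0≤inv (suc l)) (qN-mono big) ⟩
      nu                                               ∎
      where
      E = errorBound (suc l)
      swap : ∀ a b c → a * b * c ≡ a * c * b
      swap = ring-solve-∀ ℚ-ring
    error₂ : localSum (suc l) j - localSum n j ≤ nu
    error₂ = ℚₚ.≤-trans (proj₂ dev₁) (*-monoʳ (0≤inv (suc l)) (qN-mono j≤n))
    error₃ : (density (suc l) - density M) * qN j ≤ nu
    error₃ = begin
      (density (suc l) - density M) * qN j     ≤⟨ *-mono (0≤qN j) (0≤* 0≤1 (0≤inv (suc l))) (proj₂ dev₂) (qN-mono j≤n) ⟩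
      1ℚ * u * qN n                            ≡⟨ rotate u (qN n) ⟩
      nu                                       ∎
      where
      rotate : ∀ u n → 1ℚ * u * n ≡ n * u
      rotate = ring-solve-∀ ℚ-ring

  cesaro : ∀ K (x : ℕ → ℕ) → (∀ m → qN (x (suc m)) ≡ qN (suc m ℕ.^ K) * localProduct f (suc m) (suc m)) →
    CesaroEquivProd x density (ℕ._^ K)
  -- With L = l + 1, the first summand of N ensures L ≤ n and the second makes `errorBound` at L at
  -- most n / L. The threshold for M does not depend on n.
  cesaro K x x≡ ε 0<ε = suc l ℕ.+ suc l ℕ.* errorBound (suc l) , λ n N≤n → suc l , λ M l<M → bound n M N≤n l<M
    where
    open ℚₚ.≤-Reasoning
    -- The 6 is twice 3, for the two terms of `weighted-sum-bound` and the three errors of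
    -- `partial-deviation`; K + 1 comes from `power-sum-bound` and 4 from `density-positive`.
    threshold : Σ ℕ λ l → qN 6 * qN (suc K) * qN 4 * inv (suc l) ≤ ε
    threshold = archimedean₃ 6 (suc K) 4 ε 0<ε
    l = proj₁ threshold
    small = proj₂ threshold
    u = inv (suc l)
    w : ℕ → ℚ
    w m = qN (m ℕ.^ K)
    bound : ∀ n M → suc l ℕ.+ suc l ℕ.* errorBound (suc l) ℕ.≤ n → suc l ℕ.≤ M →
      ∣ qN (sumTo x n) - density M * qN (sumTo (ℕ._^ K) n) ∣ ≤ ε * density M * qN (sumTo (ℕ._^ K) n)
    bound n M N≤n l<M = begin
      ∣ qN (sumTo x n) - P * Y ∣
        ≡⟨ cong ∣_∣ rewriteSum ⟩
      ∣ partial (λ m → w m * (localProduct f n m - P)) n ∣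
        ≤⟨ weighted-sum-bound w (λ m → localProduct f n m - P) T (0≤qN (0 ℕ.^ K)) (λ m → qN-mono (ℕₚ.^-monoˡ-≤ K (ℕₚ.n≤1+n m))) n
             (λ j j≤n → partial-deviation l n M j (ℕₚ.≤-trans (ℕₚ.m≤m+n (suc l) _) N≤n) l<M j≤n
               (ℕₚ.≤-trans (ℕₚ.m≤n+m _ (suc l)) N≤n)) ⟩
      w n * T + w n * T
        ≤⟨ error-estimate {w n} {qN n} {qN (suc K)} {Y} {u} {P} {ε} {qN 3} {qN 6} {qN 4} {inv 4}
             (0≤inv (suc l)) (0≤qN (sumTo (ℕ._^ K) n)) (ℚₚ.<⇒≤ 0<ε) (0≤qN 6) (0≤inv 4) refl refl powers small (density-positive M) ⟩
      ε * P * Y ∎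
      where
      P = density M
      Y = qN (sumTo (ℕ._^ K) n)
      T = qN 3 * (qN n * u)
      powers : qN n * w n ≤ qN (suc K) * Y
      powers = subst₂ _≤_ (qN-* n (n ℕ.^ K)) (qN-* (suc K) (sumTo (ℕ._^ K) n)) (qN-mono (power-sum-bound K n))
      distribute : ∀ w t p → w * t - p * w ≡ w * (t - p)
      distribute = ring-solve-∀ ℚ-ring
      term : ∀ m → suc m ℕ.≤ n → qN (x (suc m)) ≡ w (suc m) * localProduct f n (suc m)
      term m m<n = trans (x≡ m) (cong (w (suc m) *_)
        (subst (λ r → localProduct f (suc m) (suc m) ≡ localProduct f r (suc m)) (ℕₚ.m∸n+n≡m m<n) (sym (localProduct-stable m (n ℕ.∸ suc m)))))
      rewriteSum : qN (sumTo x n) - P * Y ≡ partial (λ m → w m * (localProduct f n m - P)) n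
      rewriteSum = trans
        (cong₂ (λ a b → a - P * b) (trans (qN-sumTo x n) (partial-cong n term)) (qN-sumTo (ℕ._^ K) n))
        (trans (sym (partial-linear P (λ m → w m * localProduct f n m) w n))
          (partial-cong n λ m _ → distribute (w (suc m)) (localProduct f n (suc m)) P))

-- Sieving vectors by common prime factors

prime-divisor : ∀ d → d ≢ 0 → d ≢ 1 → Σ ℕ λ p → Prime p × p ∣ₙ d
prime-divisor d d≢0 d≢1 with factorise d {{ℕ.≢-nonZero d≢0}}
... | record { factors = List.[] ; isFactorisation = d≡1 } = contradiction d≡1 d≢1
... | record { factors = p List.∷ ps ; isFactorisation = d≡ ; factorsPrime = pr All.∷ _ } =
  p , pr , subst (p ∣ₙ_) (sym d≡) (m∣m*n (product ps))

CommonPrime : ℕ → ℕ → ℕ → Set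
CommonPrime n g p = Prime p × p ∣ₙ n × p ∣ₙ g

commonPrime? : ∀ n g p → Dec (CommonPrime n g p)
commonPrime? n g p = prime? p ×-dec (p ∣? n ×-dec p ∣? g)

-- L interpolates between all vectors, at L = 0, and the vectors counted by `jordan`, at L = n.
sieve : ℕ → ℕ → ℕ → ℕ
sieve zero    n g = 1
sieve (suc L) n g = if does (commonPrime? n g (suc L)) then 0 else sieve L n g

sieve-hit : ∀ L {n g} → CommonPrime n g (suc L) → sieve (suc L) n g ≡ 0
sieve-hit L {n} {g} c = cong (λ b → if b then 0 else sieve L n g) (dec-true (commonPrime? n g (suc L)) c)

sieve-miss : ∀ L {n g} → ¬ CommonPrime n g (suc L) → sieve (suc L) n g ≡ sieve L n g
sieve-miss L {n} {g} ¬c = cong (λ b → if b then 0 else sieve L n g) (dec-false (commonPrime? n g (suc L)) ¬c)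

sieve-none : ∀ L {n g} → (∀ p → ¬ CommonPrime n g p) → sieve L n g ≡ 1
sieve-none zero    none = refl
sieve-none (suc L) none = trans (sieve-miss L (none (suc L))) (sieve-none L none)

sieve-some : ∀ L {n g p} → p ℕ.≤ L → CommonPrime n g p → sieve L n g ≡ 0
sieve-some zero    ℕ.z≤n (pr , _) = contradiction pr ¬prime[0]
sieve-some (suc L) {n} {g} {p} p≤1+L c with p ℕ.≟ suc L
... | yes refl = sieve-hit L c
... | no p≢1+L with commonPrime? n g (suc L)
...   | yes c′ = sieve-hit L c′
...   | no ¬c  = trans (sieve-miss L ¬c) (sieve-some L (ℕ.s≤s⁻¹ (ℕₚ.≤∧≢⇒< p≤1+L p≢1+L)) c)

sieve-full : ∀ m g → sieve (suc m) (suc m) g ≡ indicator (gcd g (suc m) ℕ.≟ 1)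
sieve-full m g = cases (gcd g n ℕ.≟ 1)
  where
  n = suc m
  cases : Dec (gcd g n ≡ 1) → sieve n n g ≡ indicator (gcd g n ℕ.≟ 1)
  cases (yes g⊥n) = trans (sieve-none n λ p (pr , p∣n , p∣g) →
    ¬prime[1] (subst Prime (∣1⇒≡1 (subst (p ∣ₙ_) g⊥n (gcd-greatest p∣g p∣n))) pr))
    (sym (indicator-true (gcd g n ℕ.≟ 1) g⊥n))
  cases (no g⊥̸n) with prime-divisor (gcd g n) (gcd[m,n]≢0 g n (inj₂ ℕₚ.1+n≢0)) g⊥̸n
  ... | p , pr , p∣d = trans
    (sieve-some n (∣⇒≤ p∣n) (pr , p∣n , ∣-trans p∣d (gcd[m,n]∣m g n)))
    (sym (indicator-false (gcd g n ℕ.≟ 1) g⊥̸n))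
    where p∣n = ∣-trans p∣d (gcd[m,n]∣n g n)

sieve-scale : ∀ {p} → Prime p → ∀ L → L ℕ.< p → ∀ n g → sieve L (n ℕ.* p) (g ℕ.* p) ≡ sieve L n g
sieve-scale pr zero    L<p n g = refl
sieve-scale {p} pr (suc L) L<p n g = cong₂ (λ b s → if b then 0 else s)
  (does-⇔ (mk⇔ (λ (prq , q∣np , q∣gp) → prq , prime-∣-cancelʳ pr prq L<p n q∣np , prime-∣-cancelʳ pr prq L<p g q∣gp)
               (λ (prq , q∣n , q∣g) → prq , ∣m⇒∣m*n p q∣n , ∣m⇒∣m*n p q∣g))
    (commonPrime? (n ℕ.* p) (g ℕ.* p) (suc L)) (commonPrime? n g (suc L)))
  (sieve-scale pr L (ℕₚ.<-trans (ℕₚ.n<1+n L) L<p) n g)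

gcdVec-cong : ∀ {k} {v w : Fin k → ℤ} → (∀ i → v i ≡ w i) → gcdVec v ≡ gcdVec w
gcdVec-cong {zero}  v≡w = refl
gcdVec-cong {suc k} v≡w = cong₂ (λ a g → gcd ℤ.∣ a ∣ g) (v≡w zero) (gcdVec-cong (v≡w ∘ suc))

gcdVec-scale : ∀ {k} p (v : Fin k → ℤ) → gcdVec (λ i → v i ℤ.* + p) ≡ gcdVec v ℕ.* p
gcdVec-scale {zero}  p v = refl
gcdVec-scale {suc k} p v = begin
  gcd ℤ.∣ v zero ℤ.* + p ∣ (gcdVec (λ i → v (suc i) ℤ.* + p))
    ≡⟨ cong₂ gcd (trans (ℤₚ.abs-* (v zero) (+ p)) (ℕₚ.*-comm ℤ.∣ v zero ∣ p)) (trans (gcdVec-scale p (v ∘ suc)) (ℕₚ.*-comm _ p)) ⟩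
  gcd (p ℕ.* ℤ.∣ v zero ∣) (p ℕ.* gcdVec (v ∘ suc))
    ≡⟨ c*gcd[m,n]≡gcd[cm,cn] p ℤ.∣ v zero ∣ (gcdVec (v ∘ suc)) ⟨
  p ℕ.* gcdVec v                                               ≡⟨ ℕₚ.*-comm p (gcdVec v) ⟩
  gcdVec v ℕ.* p                                               ∎
  where open ≡-Reasoning

module ℕ-Sum = PartialSum ℕ._+_ 0 ℕₚ.+-identityʳ

sumTo≡partial : ∀ f n → sumTo f n ≡ ℕ-Sum.partial f n
sumTo≡partial f zero    = refl
sumTo≡partial f (suc n) = cong (ℕ._+ f (suc n)) (sumTo≡partial f n)

residueSum-multiples : ∀ p .{{_ : NonZero p}} q {f : ℤ → ℕ} → (∀ a → ¬ p ∣ₙ a → f (+ a) ≡ 0) →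
  residueSum (q ℕ.* p) f ≡ residueSum q (λ b → f (b ℤ.* + p))
residueSum-multiples p q {f} off = begin
  sumTo (λ a → f (+ a)) (q ℕ.* p)        ≡⟨ sumTo≡partial _ (q ℕ.* p) ⟩
  ℕ-Sum.partial (λ a → f (+ a)) (q ℕ.* p)
    ≡⟨ ℕ-Sum.partial-multiples p off (q ℕ.* p) q ℕₚ.≤-refl (ℕₚ.m<n+m (q ℕ.* p) (ℕ.>-nonZero⁻¹ p)) ⟩
  ℕ-Sum.partial (λ b → f (+ (b ℕ.* p))) q      ≡⟨ sumTo≡partial _ q ⟨
  sumTo (λ b → f (+ (b ℕ.* p))) q        ≡⟨ sumTo-cong (λ b → cong f (ℤₚ.pos-* b p)) q ⟩
  sumTo (λ b → f (+ b ℤ.* + p)) q        ∎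
  where open ≡-Reasoning

-- A prefix entry that p does not divide already prevents p from dividing the gcd, so each entry may
-- be restricted to p, 2p, ..., q p.
rowSum-multiples : ∀ p .{{_ : NonZero p}} q k {F : (Fin k → ℤ) → ℕ} → (∀ v w → (∀ i → v i ≡ w i) → F v ≡ F w) →
  (∀ v → ¬ p ∣ₙ gcdVec v → F v ≡ 0) → rowSum (q ℕ.* p) k F ≡ rowSum q k (λ w → F (λ i → w i ℤ.* + p))
rowSum-multiples p q zero    resp off = resp _ _ λ ()
rowSum-multiples p q (suc k) {F} resp off = begin
  residueSum (q ℕ.* p) (λ a → rowSum (q ℕ.* p) k (λ v → F (a ∷ v)))
    ≡⟨ residueSum-multiples p q {λ a → rowSum (q ℕ.* p) k (λ v → F (a ∷ v))} (λ a p∤a → trans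
         (∑-cong (rowSum-isSum (q ℕ.* p) k) λ v → off (+ a ∷ v) λ p∣g → p∤a (∣-trans p∣g (gcd[m,n]∣m a (gcdVec v))))
         (∑-zero (rowSum-isSum (q ℕ.* p) k))) ⟩
  residueSum q (λ b → rowSum (q ℕ.* p) k (λ v → F (b ℤ.* + p ∷ v)))
    ≡⟨ ∑-cong (residueSum-isSum q) (λ b → trans
         (rowSum-multiples p q k (λ v w v≡w → resp _ _ λ { zero → refl ; (suc i) → v≡w i })
           (λ v p∤g → off (b ℤ.* + p ∷ v) λ p∣g → p∤g (∣-trans p∣g (gcd[m,n]∣n ℤ.∣ b ℤ.* + p ∣ (gcdVec v)))))
         (∑-cong (rowSum-isSum q k) λ w → resp _ (λ i → (b ∷ w) i ℤ.* + p) λ { zero → refl ; (suc i) → refl })) ⟩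
  residueSum q (λ b → rowSum q k (λ w → F (λ i → (b ∷ w) i ℤ.* + p))) ∎
  where open ≡-Reasoning

sievedVectors : ℕ → ℕ → ℕ → ℕ
sievedVectors k L n = rowSum n k (λ v → sieve L n (gcdVec v))

-- Split the vectors that survive up to L by divisibility by p = L + 1. The divisible ones are p w
-- with w modulo q = n / p, and cancelling p alters no condition at a prime below p. The subtraction
-- is written as a sum in ℕ.
sievedVectors-prime : ∀ k {L} → Prime (suc L) → ∀ q →
  sievedVectors k (suc L) (q ℕ.* suc L) ℕ.+ sievedVectors k L q ≡ sievedVectors k L (q ℕ.* suc L)
sievedVectors-prime k {L} pr q = begin
  sievedVectors k (suc L) n ℕ.+ sievedVectors k L q
    ≡⟨ cong (sievedVectors k (suc L) n ℕ.+_) (begin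
         rowSum q k (λ w → sieve L q (gcdVec w))
           ≡⟨ ∑-cong (rowSum-isSum q k) (λ w → trans
                (cong₂ (λ b s → if b then s else 0) (dec-true (p ∣? gcdVec (λ i → w i ℤ.* + p)) (subst (p ∣ₙ_) (sym (gcdVec-scale p w)) (n∣m*n (gcdVec w))))
                  (cong (sieve L n) (gcdVec-scale p w)))
                (sieve-scale pr L ℕₚ.≤-refl q (gcdVec w))) ⟨
         rowSum q k (λ w → onMultiples (λ i → w i ℤ.* + p))
           ≡⟨ rowSum-multiples p q k (λ v w v≡w → cong (λ g → if does (p ∣? g) then sieve L n g else 0) (gcdVec-cong v≡w))
                (λ v p∤g → cong (λ b → if b then sieve L n (gcdVec v) else 0) (dec-false (p ∣? gcdVec v) p∤g)) ⟨
         rowSum n k onMultiples ∎) ⟩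
  sievedVectors k (suc L) n ℕ.+ rowSum n k onMultiples
    ≡⟨ ∑-+ (rowSum-isSum n k) (λ v → sieve (suc L) n (gcdVec v)) onMultiples ⟨
  rowSum n k (λ v → sieve (suc L) n (gcdVec v) ℕ.+ onMultiples v)
    ≡⟨ ∑-cong (rowSum-isSum n k) (λ v → split (gcdVec v) (p ∣? gcdVec v)) ⟩
  sievedVectors k L n ∎
  where
  open ≡-Reasoning
  p = suc L
  n = q ℕ.* p
  onMultiples : (Fin k → ℤ) → ℕ
  onMultiples v = if does (p ∣? gcdVec v) then sieve L n (gcdVec v) else 0
  split : ∀ g → Dec (p ∣ₙ g) → sieve (suc L) n g ℕ.+ (if does (p ∣? g) then sieve L n g else 0) ≡ sieve L n g
  split g (yes p∣g) = cong₂ (λ s b → s ℕ.+ (if b then sieve L n g else 0)) (sieve-hit L (pr , n∣m*n q , p∣g)) (dec-true (p ∣? g) p∣g)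
  split g (no p∤g) = trans (cong₂ (λ s b → s ℕ.+ (if b then sieve L n g else 0)) (sieve-miss L λ (_ , _ , p∣g) → p∤g p∣g) (dec-false (p ∣? g) p∤g))
    (ℕₚ.+-identityʳ _)

sievedVectors-skip : ∀ k L n → ¬ (Prime (suc L) × suc L ∣ₙ n) → sievedVectors k (suc L) n ≡ sievedVectors k L n
sievedVectors-skip k L n skip = ∑-cong (rowSum-isSum n k) λ v → sieve-miss L λ (pr , p∣n , _) → skip (pr , p∣n)

-- Local densities

qN*inv-nonZero : ∀ n .{{_ : NonZero n}} → qN n * inv n ≡ 1ℚ
qN*inv-nonZero (suc n) = qN*inv n

^-distribʳ-* : ∀ k a b → (a ℕ.* b) ℕ.^ k ≡ a ℕ.^ k ℕ.* b ℕ.^ k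
^-distribʳ-* zero    a b = refl
^-distribʳ-* (suc k) a b rewrite ^-distribʳ-* k a b = lemma a b (a ℕ.^ k) (b ℕ.^ k)
  where
  lemma : ∀ a b x y → a ℕ.* b ℕ.* (x ℕ.* y) ≡ a ℕ.* x ℕ.* (b ℕ.* y)
  lemma = ℕ-solve-∀

eulerFactor : ℕ → ℕ → ℚ
eulerFactor p i = 1ℚ - inv (p ℕ.^ i)

localProduct-* : ∀ f g L n → localProduct (λ p → f p * g p) L n ≡ localProduct f L n * localProduct g L n
localProduct-* f g zero    n = refl
localProduct-* f g (suc L) n = cases (prime? (suc L)) (suc L ∣? n)
  where
  lemma : ∀ a b x y → a * b * (x * y) ≡ a * x * (b * y)
  lemma = ring-solve-∀ ℚ-ring
  unchanged : ¬ (Prime (suc L) × suc L ∣ₙ n) →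
    localProduct (λ p → f p * g p) (suc L) n ≡ localProduct f (suc L) n * localProduct g (suc L) n
  unchanged skip = trans (localProduct-skip (λ p → f p * g p) skip) (trans (localProduct-* f g L n)
    (sym (cong₂ _*_ (localProduct-skip f skip) (localProduct-skip g skip))))
  cases : Dec (Prime (suc L)) → Dec (suc L ∣ₙ n) →
    localProduct (λ p → f p * g p) (suc L) n ≡ localProduct f (suc L) n * localProduct g (suc L) n
  cases (no ¬pr) _         = unchanged λ (pr , _) → ¬pr pr
  cases (yes pr) (no p∤n)  = unchanged λ (_ , p∣n) → p∤n p∣n
  cases (yes pr) (yes p∣n) = begin
    localProduct (λ p → f p * g p) (suc L) n
      ≡⟨ localProduct-∣ (λ p → f p * g p) pr p∣n ⟩
    localProduct (λ p → f p * g p) L n * (f (suc L) * g (suc L))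
      ≡⟨ cong (_* (f (suc L) * g (suc L))) (localProduct-* f g L n) ⟩
    localProduct f L n * localProduct g L n * (f (suc L) * g (suc L))
      ≡⟨ lemma (localProduct f L n) (localProduct g L n) (f (suc L)) (g (suc L)) ⟩
    localProduct f L n * f (suc L) * (localProduct g L n * g (suc L))
      ≡⟨ cong₂ _*_ (localProduct-∣ f pr p∣n) (localProduct-∣ g pr p∣n) ⟨
    localProduct f (suc L) n * localProduct g (suc L) n ∎
    where open ≡-Reasoning

-- The products up to L for q and for q p coincide whatever power of p divides q, so the step at p
-- removes exactly the proportion p^(-k).
sievedVectors-product : ∀ k L n → qN (sievedVectors k L n) ≡ qN (n ℕ.^ k) * localProduct (λ p → eulerFactor p k) L n
sievedVectors-product k zero n = trans (cong qN (trans (rowSum-const n k 1) (ℕₚ.*-identityʳ (n ℕ.^ k)))) (sym (ℚₚ.*-identityʳ (qN (n ℕ.^ k))))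
sievedVectors-product k (suc L) n = cases (prime? (suc L)) (suc L ∣? n)
  where
  f : ℕ → ℚ
  f p = eulerFactor p k
  unchanged : ∀ n → ¬ (Prime (suc L) × suc L ∣ₙ n) → qN (sievedVectors k (suc L) n) ≡ qN (n ℕ.^ k) * localProduct f (suc L) n
  unchanged n skip = trans (cong qN (sievedVectors-skip k L n skip)) (trans (sievedVectors-product k L n)
    (cong (qN (n ℕ.^ k) *_) (sym (localProduct-skip f skip))))
  divisible : Prime (suc L) → ∀ q → qN (sievedVectors k (suc L) (q ℕ.* suc L)) ≡ qN ((q ℕ.* suc L) ℕ.^ k) * localProduct f (suc L) (q ℕ.* suc L)
  divisible pr q = begin
    x                               ≡⟨ subtract x (qN (sievedVectors k L q)) ⟩
    x + qN (sievedVectors k L q) - qN (sievedVectors k L q)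
      ≡⟨ cong₂ _-_ (trans (sym (qN-+ (sievedVectors k (suc L) (q ℕ.* suc L)) (sievedVectors k L q)))
                          (trans (cong qN (sievedVectors-prime k pr q)) (sievedVectors-product k L (q ℕ.* suc L))))
                   (sievedVectors-product k L q) ⟩
    qN ((q ℕ.* suc L) ℕ.^ k) * E - qN (q ℕ.^ k) * localProduct f L q
      ≡⟨ cong₂ (λ a b → a * E - qN (q ℕ.^ k) * b) power (sym (localProduct-coprime f L pr ℕₚ.≤-refl q)) ⟩
    Q * R * E - Q * E               ≡⟨ cong (λ y → Q * R * E - y) (sym (ℚₚ.*-identityʳ (Q * E))) ⟩
    Q * R * E - Q * E * 1ℚ
      ≡⟨ cong (λ y → Q * R * E - Q * E * y) (qN*inv-nonZero (suc L ℕ.^ k) {{ℕₚ.m^n≢0 (suc L) k}}) ⟨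
    Q * R * E - Q * E * (R * inv (suc L ℕ.^ k)) ≡⟨ factor Q R E (inv (suc L ℕ.^ k)) ⟩
    Q * R * (E * f (suc L))         ≡⟨ cong₂ _*_ power (localProduct-∣ f pr (n∣m*n q)) ⟨
    qN ((q ℕ.* suc L) ℕ.^ k) * localProduct f (suc L) (q ℕ.* suc L) ∎
    where
    open ≡-Reasoning
    x = qN (sievedVectors k (suc L) (q ℕ.* suc L))
    E = localProduct f L (q ℕ.* suc L)
    Q = qN (q ℕ.^ k)
    R = qN (suc L ℕ.^ k)
    power : qN ((q ℕ.* suc L) ℕ.^ k) ≡ Q * R
    power = trans (cong qN (^-distribʳ-* k q (suc L))) (qN-* (q ℕ.^ k) (suc L ℕ.^ k))
    subtract : ∀ x y → x ≡ x + y - y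
    subtract = ring-solve-∀ ℚ-ring
    factor : ∀ Q R E i → Q * R * E - Q * E * (R * i) ≡ Q * R * (E * (1ℚ - i))
    factor = ring-solve-∀ ℚ-ring
  cases : Dec (Prime (suc L)) → Dec (suc L ∣ₙ n) → qN (sievedVectors k (suc L) n) ≡ qN (n ℕ.^ k) * localProduct f (suc L) n
  cases (no ¬pr) _         = unchanged n λ (pr , _) → ¬pr pr
  cases (yes pr) (no p∤n)  = unchanged n λ (_ , p∣n) → p∤n p∣n
  cases (yes pr) (yes (divides q refl)) = divisible pr q

jordan-product : ∀ k m → let n = suc m in qN (Counting.jordan m k) ≡ qN (n ℕ.^ k) * localProduct (λ p → eulerFactor p k) n n
jordan-product k m = trans (cong qN (∑-cong (rowSum-isSum (suc m) k) λ v → sym (sieve-full m (gcdVec v))))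
  (sievedVectors-product k (suc m) (suc m))

-- One induction on the size for both groups: s is the order, e the exponent of n, f the local
-- factor. Passing to size k + 2 adds k + 1 to the exponent for the free column and k + 2 for the
-- Jordan totient.
count-product : ∀ m (s e : ℕ → ℕ) (f : ℕ → ℕ → ℚ) → let n = suc m in
  (∀ k p → f (suc (suc k)) p ≡ f (suc k) p * eulerFactor p (suc (suc k))) →
  (∀ k → e (suc (suc k)) ≡ suc k ℕ.+ e (suc k) ℕ.+ suc (suc k)) →
  (∀ k → s (suc (suc k)) ≡ n ℕ.^ suc k ℕ.* s (suc k) ℕ.* Counting.jordan m (suc (suc k))) →
  qN (s 1) ≡ qN (n ℕ.^ e 1) * localProduct (f 1) n n →
  ∀ k → qN (s (suc k)) ≡ qN (n ℕ.^ e (suc k)) * localProduct (f (suc k)) n n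
count-product m s e f f-suc e-suc s-suc base zero    = base
count-product m s e f f-suc e-suc s-suc base (suc k) = begin
  qN (s (suc (suc k)))
    ≡⟨ cong qN (s-suc k) ⟩
  qN (n ℕ.^ suc k ℕ.* s (suc k) ℕ.* jₖ)
    ≡⟨ trans (qN-* (n ℕ.^ suc k ℕ.* s (suc k)) jₖ) (cong (_* qN jₖ) (qN-* (n ℕ.^ suc k) (s (suc k)))) ⟩
  A * qN (s (suc k)) * qN jₖ
    ≡⟨ cong₂ (λ x y → A * x * y) (count-product m s e f f-suc e-suc s-suc base k) (jordan-product (suc (suc k)) m) ⟩
  A * (B * X) * (C * Y)
    ≡⟨ lemma A B C X Y ⟩
  A * B * C * (X * Y)
    ≡⟨ cong₂ _*_ powers (localProduct-* (f (suc k)) (λ p → eulerFactor p (suc (suc k))) n n) ⟨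
  qN (n ℕ.^ e (suc (suc k))) * localProduct (λ p → f (suc k) p * eulerFactor p (suc (suc k))) n n
    ≡⟨ cong (qN (n ℕ.^ e (suc (suc k))) *_) (primeProd-cong n λ p _ _ → cong (λ x → if does (p ∣? n) then x else 1ℚ) (f-suc k p)) ⟨
  qN (n ℕ.^ e (suc (suc k))) * localProduct (f (suc (suc k))) n n ∎
  where
  open ≡-Reasoning
  n = suc m
  jₖ = Counting.jordan m (suc (suc k))
  A = qN (n ℕ.^ suc k)
  B = qN (n ℕ.^ e (suc k))
  C = qN (n ℕ.^ suc (suc k))
  X = localProduct (f (suc k)) n n
  Y = localProduct (λ p → eulerFactor p (suc (suc k))) n n
  lemma : ∀ a b c x y → a * (b * x) * (c * y) ≡ a * b * c * (x * y)
  lemma = ring-solve-∀ ℚ-ring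
  powers : qN (n ℕ.^ e (suc (suc k))) ≡ A * B * C
  powers = begin
    qN (n ℕ.^ e (suc (suc k)))                                          ≡⟨ cong (λ j → qN (n ℕ.^ j)) (e-suc k) ⟩
    qN (n ℕ.^ (suc k ℕ.+ e (suc k) ℕ.+ suc (suc k)))
      ≡⟨ cong qN (ℕₚ.^-distribˡ-+-* n (suc k ℕ.+ e (suc k)) (suc (suc k))) ⟩
    qN (n ℕ.^ (suc k ℕ.+ e (suc k)) ℕ.* n ℕ.^ suc (suc k))
      ≡⟨ qN-* (n ℕ.^ (suc k ℕ.+ e (suc k))) (n ℕ.^ suc (suc k)) ⟩
    qN (n ℕ.^ (suc k ℕ.+ e (suc k))) * C
      ≡⟨ cong (λ j → qN j * C) (ℕₚ.^-distribˡ-+-* n (suc k) (e (suc k))) ⟩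
    qN (n ℕ.^ suc k ℕ.* n ℕ.^ e (suc k)) * C
      ≡⟨ cong (_* C) (qN-* (n ℕ.^ suc k) (n ℕ.^ e (suc k))) ⟩
    A * B * C                                                           ∎

-- The f(p) of the mean value argument, with a = 2 for SL and a = 1 for GL.
localDensity : ℕ → ℕ → ℕ → ℚ
localDensity a k p = prodFrom a k (eulerFactor p)

-- The defect of a product of terms 1 - p^(-i) is at most the sum of the p^(-i) for 1 ≤ i ≤ k, and p
-- - 1 times this geometric sum is 1 - p^(-k). Keeping the exact value, in place of 1, is what lets
-- the induction on k close.
localDensity-bounds : ∀ a k l → let p = suc (suc l) in
  UnitInterval (localDensity a k p) × qN (suc l) * (1ℚ - localDensity a k p) ≤ 1ℚ - inv (p ℕ.^ k)
localDensity-bounds a zero    l = unit-one , ℚₚ.≤-reflexive (lemma (qN (suc l)))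
  where
  lemma : ∀ s → s * (1ℚ - 1ℚ) ≡ 1ℚ - 1ℚ
  lemma = ring-solve-∀ ℚ-ring
localDensity-bounds a (suc k) l = cases (does (a ℕ.≤? suc k)) refl
  where
  p = suc (suc l)
  s = qN (suc l)
  v = inv p
  i = inv (p ℕ.^ k)
  i′ = inv (p ℕ.^ suc k)
  F = localDensity a k p
  F-unit : UnitInterval F
  F-unit = proj₁ (localDensity-bounds a k l)
  ih : s * (1ℚ - F) ≤ 1ℚ - i
  ih = proj₂ (localDensity-bounds a k l)
  i′≡ : i′ ≡ v * i
  i′≡ = inv-* p (p ℕ.^ k)
  si′≡ : s * i′ ≡ i - i′
  si′≡ = begin
    s * i′                       ≡⟨ cong (s *_) i′≡ ⟩
    s * (v * i)                  ≡⟨ expand s v i ⟩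
    (1ℚ + s) * v * i - v * i     ≡⟨ cong₂ (λ x y → x * v * i - y) (sym (qN-+ 1 (suc l))) (sym i′≡) ⟩
    qN p * v * i - i′            ≡⟨ cong (λ x → x * i - i′) (qN*inv (suc l)) ⟩
    1ℚ * i - i′                  ≡⟨ cong (_- i′) (ℚₚ.*-identityˡ i) ⟩
    i - i′                       ∎
    where
    open ≡-Reasoning
    expand : ∀ s v i → s * (v * i) ≡ (1ℚ + s) * v * i - v * i
    expand = ring-solve-∀ ℚ-ring
  0≤si′ : 0ℚ ≤ s * i′
  0≤si′ = 0≤* (0≤qN (suc l)) (0≤inv (p ℕ.^ suc k))
  skipped : s * (1ℚ - F) ≤ 1ℚ - i′
  skipped = ℚₚ.≤-trans ih (≤-by (s * i′) 0≤si′ (trans (lemma i i′) (cong (λ y → 1ℚ - i + y) (sym si′≡))))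
    where
    lemma : ∀ i j → 1ℚ - j ≡ 1ℚ - i + (i - j)
    lemma = ring-solve-∀ ℚ-ring
  included : s * (1ℚ - F * (1ℚ - i′)) ≤ 1ℚ - i′
  included = ≤-by (1ℚ - i - s * (1ℚ - F) + s * i′ * (1ℚ - F)) (0≤+ (≤⇒0≤- ih) (0≤* 0≤si′ (≤⇒0≤- (proj₂ F-unit))))
    (trans (split i i′) (trans (cong (λ y → 1ℚ - i + y) (sym si′≡)) (lemma i i′ s F)))
    where
    split : ∀ i j → 1ℚ - j ≡ 1ℚ - i + (i - j)
    split = ring-solve-∀ ℚ-ring
    lemma : ∀ i j s F → 1ℚ - i + s * j ≡ s * (1ℚ - F * (1ℚ - j)) + (1ℚ - i - s * (1ℚ - F) + s * j * (1ℚ - F))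
    lemma = ring-solve-∀ ℚ-ring
  cases : ∀ b → does (a ℕ.≤? suc k) ≡ b → UnitInterval (localDensity a (suc k) p) × s * (1ℚ - localDensity a (suc k) p) ≤ 1ℚ - i′
  cases true  eq rewrite eq = unit-* F-unit (unit-complement (inv-unit (p ℕ.^ suc k))) , included
  cases false eq rewrite eq = F-unit , skipped

localDensity-near-one : ∀ a k l → 1ℚ - localDensity a k (suc (suc l)) ≤ inv (suc l)
localDensity-near-one a k l = begin
  1ℚ - F                                ≡⟨ ℚₚ.*-identityˡ (1ℚ - F) ⟨
  1ℚ * (1ℚ - F)                         ≡⟨ cong (_* (1ℚ - F)) (qN*inv l) ⟨
  qN (suc l) * inv (suc l) * (1ℚ - F)   ≡⟨ rotate (qN (suc l)) (inv (suc l)) (1ℚ - F) ⟩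
  inv (suc l) * (qN (suc l) * (1ℚ - F)) ≤⟨ *-monoˡ (0≤inv (suc l)) (ℚₚ.≤-trans (proj₂ (localDensity-bounds a k l))
      (≤-by i (0≤inv (suc (suc l) ℕ.^ k)) (cancel i))) ⟩
  inv (suc l) * 1ℚ                      ≡⟨ ℚₚ.*-identityʳ (inv (suc l)) ⟩
  inv (suc l)                           ∎
  where
  open ℚₚ.≤-Reasoning
  F = localDensity a k (suc (suc l))
  i = inv (suc (suc l) ℕ.^ k)
  rotate : ∀ s u x → s * u * x ≡ u * (s * x)
  rotate = ring-solve-∀ ℚ-ring
  cancel : ∀ i → 1ℚ ≡ 1ℚ - i + i
  cancel = ring-solve-∀ ℚ-ring

factorC1-mean : ∀ k p → factorC1 (suc k) p ≡ 1ℚ - inv p * (1ℚ - localDensity 2 (suc k) p)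
factorC1-mean zero    p = lemma (inv p)
  where
  lemma : ∀ v → 1ℚ ≡ 1ℚ - v * (1ℚ - 1ℚ)
  lemma = ring-solve-∀ ℚ-ring
factorC1-mean (suc k) p = refl

-- Size 1 has its own clause in the constants but fits the general formula: here 1 - 1/p² = 1 -
-- (1/p)(1 - (1 - 1/p)), and for SL the product from 2 to 1 is empty.
factorC2-mean : ∀ k p → factorC2 (suc k) p ≡ 1ℚ - inv p * (1ℚ - localDensity 1 (suc k) p)
factorC2-mean zero    p = trans (cong (λ y → 1ℚ - y) (inv-* p (p ℕ.^ 1))) (lemma (inv p) (inv (p ℕ.^ 1)))
  where
  lemma : ∀ v w → 1ℚ - v * w ≡ 1ℚ - v * (1ℚ - 1ℚ * (1ℚ - w))
  lemma = ring-solve-∀ ℚ-ring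
factorC2-mean (suc k) p = refl

cesaro-localDensity : ∀ a k K (x : ℕ → ℕ) (factor : ℕ → ℚ) →
  (∀ p → factor p ≡ 1ℚ - inv p * (1ℚ - localDensity a k p)) →
  (∀ m → qN (x (suc m)) ≡ qN (suc m ℕ.^ K) * localProduct (localDensity a k) (suc m) (suc m)) →
  CesaroEquivProd x (primeProd factor) (λ n → n ℕ.^ K)
cesaro-localDensity a k K x factor factor≡ x≡ ε 0<ε =
  let N , close = Cesaro.cesaro (localDensity a k) (λ l → proj₁ (localDensity-bounds a k l)) (localDensity-near-one a k) K x x≡ ε 0<ε
  in N , λ n N≤n → proj₁ (close n N≤n) , λ M M₀≤M →
    subst (λ D → ∣ qN (sumTo x n) - D * qN (sumTo (ℕ._^ K) n) ∣ ≤ ε * D * qN (sumTo (ℕ._^ K) n))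
      (primeProd-cong M λ p _ _ → sym (factor≡ p)) (proj₂ (close n N≤n) M M₀≤M)

SL-count : ∀ k m → qN (#SL (suc k) m) ≡ qN (suc m ℕ.^ (suc k ℕ.* suc k ℕ.∸ 1)) * localProduct (localDensity 2 (suc k)) (suc m) (suc m)
SL-count k m = count-product m (λ k → #SL k m) (λ k → k ℕ.* k ℕ.∸ 1) (localDensity 2) (λ k p → refl) exponent (Counting.SL-suc m) base k
  where
  -- Both truncated subtractions, (k+2)² ∸ 1 and (k+1)² ∸ 1, have computed away by removing a
  -- successor, which leaves a ring identity.
  exponent : ∀ k → suc k ℕ.+ suc k ℕ.* suc (suc k) ≡ suc k ℕ.+ (k ℕ.+ k ℕ.* suc k) ℕ.+ suc (suc k)
  exponent = ℕ-solve-∀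
  ones : ∀ L n → localProduct (λ _ → 1ℚ) L n ≡ 1ℚ
  ones zero    n = refl
  ones (suc L) n = cases (prime? (suc L)) (suc L ∣? n)
    where
    cases : Dec (Prime (suc L)) → Dec (suc L ∣ₙ n) → localProduct (λ _ → 1ℚ) (suc L) n ≡ 1ℚ
    cases (no ¬pr) _         = trans (localProduct-skip (λ _ → 1ℚ) λ (pr , _) → ¬pr pr) (ones L n)
    cases (yes pr) (no p∤n)  = trans (localProduct-skip (λ _ → 1ℚ) λ (_ , p∣n) → p∤n p∣n) (ones L n)
    cases (yes pr) (yes p∣n) = trans (localProduct-∣ (λ _ → 1ℚ) pr p∣n) (trans (ℚₚ.*-identityʳ _) (ones L n))
  base : qN (#SL 1 m) ≡ qN 1 * localProduct (λ _ → 1ℚ) (suc m) (suc m)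
  base = trans (cong qN (Counting.SL-one m)) (sym (trans (cong (qN 1 *_) (ones (suc m) (suc m))) (ℚₚ.*-identityʳ (qN 1))))

GL-count : ∀ k m → qN (#GL (suc k) m) ≡ qN (suc m ℕ.^ (suc k ℕ.* suc k)) * localProduct (localDensity 1 (suc k)) (suc m) (suc m)
GL-count k m = count-product m (λ k → #GL k m) (λ k → k ℕ.* k) (localDensity 1) (λ k p → refl) exponent (Counting.GL-suc m) base k
  where
  exponent : ∀ k → suc (suc k) ℕ.* suc (suc k) ≡ suc k ℕ.+ suc k ℕ.* suc k ℕ.+ suc (suc k)
  exponent = ℕ-solve-∀
  base : qN (#GL 1 m) ≡ qN (suc m ℕ.^ 1) * localProduct (localDensity 1 1) (suc m) (suc m)
  base = trans (cong qN (Counting.GL-one m)) (trans (jordan-product 1 m) (cong (qN (suc m ℕ.^ 1) *_)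
    (primeProd-cong (suc m) λ p _ _ → cong (λ x → if does (p ∣? suc m) then x else 1ℚ) (sym (ℚₚ.*-identityˡ (eulerFactor p 1))))))

theorem1 : (k : ℕ) → 0 ℕ.< k →
    CesaroEquivProd (seqSL k) (primeProd (factorC1 k)) (λ n → n ℕ.^ (k ℕ.* k ℕ.∸ 1))
    × CesaroEquivProd (seqGL k) (primeProd (factorC2 k)) (λ n → n ℕ.^ (k ℕ.* k))
theorem1 (suc k) _ =
  cesaro-localDensity 2 (suc k) (suc k ℕ.* suc k ℕ.∸ 1) (seqSL (suc k)) (factorC1 (suc k)) (factorC1-mean k) (SL-count k) ,
  cesaro-localDensity 1 (suc k) (suc k ℕ.* suc k) (seqGL (suc k)) (factorC2 (suc k)) (factorC2-mean k) (GL-count k)
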